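{- For any constant $s\ge 3$ there is a one-sided error property-testing algorithm in the CONGEST model for $K_s$-freeness for graphs with maximum degree $\Delta=O\big((\epsilon m)^{\frac{1}{s-2}}\big)$ which runs in constant time, independent of $\epsilon$. That is, for every constant $s\ge3$ and every constant $\alpha>0$ there is such an algorithm for the class of network graphs satisfying $\Delta\le(\alpha\epsilon m)^{1/(s-2)}$, whose number of rounds is bounded by a constant depending only on $s$ and $\alpha$ (not on $\epsilon$, $n$ or $m$).
   Context: CONGEST model: the network is an undirected graph $G=(V,E)$ with $n=|V|$ nodes, $m=|E|$ edges and maximum degree $\Delta$, nodes have unique $O(\log n)$-bit identifiers; computation is synchronous, and in each round every node may send $O(\log n)$ bits over each incident edge; nodes have private randomness. $K_s$ is the clique on $s$ vertices. $G$ is $K_s$-free if it contains no subgraph isomorphic to $K_s$. $G$ is $\epsilon$-far from a property if at least $\epsilon|E|$ edges must be added to or removed from $E$ to obtain a graph with the property. Testing $K_s$-freeness with parameter $0<\epsilon\le 1$: if $G$ is $K_s$-free then with probability at least $2/3$ all nodes accept; if $G$ is $\epsilon$-far from $K_s$-free then with probability at least $2/3$ some node rejects. The algorithm has one-sided error if, whenever $G$ is $K_s$-free, all nodes accept with probability 1.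
   Formalization: The requirement that some node rejects on graphs ε-far from K_s-free is stated only for graphs with at least one edge, since an edgeless graph is literally both K_s-free and ε-far, making the two requirements contradictory there. -}

module Defs where

open import Data.Bool.Base using (Bool; true; false; T; not; _∧_; _xor_)
open import Data.Bool.ListAction using (all; any)
open import Data.Fin.Base using (Fin)
import Data.Fin.Base as Fin
import Data.Fin.Properties as Fin
open import Data.Integer.Base using (+_)
open import Data.List.Base
  using (List; []; _∷_; length; map; filterᵇ; allFin; cartesianProduct; cartesianProductWith)
open import Data.List.Extrema.Nat using (max)
open import Data.Nat.Base using (ℕ; zero; suc; NonZero; _∸_; _^_)
import Data.Nat.Base as ℕ
open import Data.Nat.Logarithm using (⌈log₂_⌉)
open import Data.Product.Base using (Σ; ∃; ∃-syntax; _×_; _,_; proj₁; proj₂)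
open import Data.Rational.Base using (ℚ; 0ℚ; 1ℚ; _/_; _+_; _*_; _-_; ∣_∣; _≤_; _<_)
open import Data.Vec.Base using (Vec; []; _∷_; lookup)
open import Data.Vec.Bounded.Base using (Vec≤)
open import Function.Base using (_∘_)
open import Function.Bundles using (_↔_; Inverse)
open import Function.Definitions using (Injective)
open import Relation.Binary.PropositionalEquality.Core using (_≡_; refl; subst; sym)
open import Relation.Nullary.Decidable.Core using (⌊_⌋; yes; no)
open import Relation.Nullary.Negation.Core using (¬_; contradiction)

------------------------------------------------------------------------
-- Real parameters
--
-- A real number is a Cauchy sequence of rationals.  Arithmetic on reals is
-- pointwise, and order relations are stated on sequences, so that an
-- inequality between arithmetic expressions in reals can be written without
-- carrying Cauchy proofs for the subexpressions.

record ℝ : Set where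
  field
    seq    : ℕ → ℚ
    cauchy : ∀ δ → 0ℚ < δ →
             ∃[ N ] (∀ i j → N ℕ.≤ i → N ℕ.≤ j → ∣ seq i - seq j ∣ ≤ δ)

open ℝ public

infix  4 _≤ˢ_
infixl 7 _*ˢ_

_≤ˢ_ : (ℕ → ℚ) → (ℕ → ℚ) → Set
x ≤ˢ y = ∀ δ → 0ℚ < δ → ∃[ N ] (∀ i → N ℕ.≤ i → x i ≤ y i + δ)

Positive : ℝ → Set
Positive x = ∃[ δ ] (0ℚ < δ × ∃[ N ] (∀ i → N ℕ.≤ i → δ ≤ seq x i))

_*ˢ_ : (ℕ → ℚ) → (ℕ → ℚ) → (ℕ → ℚ)
(x *ˢ y) i = x i * y i

fromℕ : ℕ → (ℕ → ℚ)
fromℕ k _ = + k / 1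

------------------------------------------------------------------------
-- Finite simple undirected graphs

record Graph (n : ℕ) : Set where
  field
    adj    : Fin n → Fin n → Bool
    symm   : ∀ u v → adj u v ≡ adj v u
    irrefl : ∀ v → adj v v ≡ false

open Graph public

Edge : ∀ {n} → Graph n → Fin n → Fin n → Set
Edge G u v = T (adj G u v)

Edge-sym : ∀ {n} (G : Graph n) {u v} → Edge G u v → Edge G v u
Edge-sym G {u} {v} = subst T (symm G u v)

-- For a symmetric relation, the number of unordered pairs {u , v}, u ≠ v,
-- that it relates.
countPairs : ∀ {n} → (Fin n → Fin n → Bool) → ℕ
countPairs {n} r =
  length (filterᵇ (λ (u , v) → ⌊ u Fin.<? v ⌋ ∧ r u v)
                  (cartesianProduct (allFin n) (allFin n)))

size : ∀ {n} → Graph n → ℕ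
size G = countPairs (adj G)

-- The number of edges to add or remove in order to turn G into H.
distance : ∀ {n} → Graph n → Graph n → ℕ
distance G H = countPairs (λ u v → adj G u v xor adj H u v)

degree : ∀ {n} → Graph n → Fin n → ℕ
degree {n} G v = length (filterᵇ (adj G v) (allFin n))

maxDegree : ∀ {n} → Graph n → ℕ
maxDegree {n} G = max 0 (map (degree G) (allFin n))

K : ∀ s → Graph s
K s = record
  { adj    = λ u v → not ⌊ u Fin.≟ v ⌋
  ; symm   = symmetric
  ; irrefl = irreflexive
  }
  where
  symmetric : ∀ (u v : Fin s) → not ⌊ u Fin.≟ v ⌋ ≡ not ⌊ v Fin.≟ u ⌋
  symmetric u v with u Fin.≟ v | v Fin.≟ u
  ... | yes _ | yes _ = refl
  ... | yes p | no ¬q = contradiction (sym p) ¬q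
  ... | no ¬p | yes q = contradiction (sym q) ¬p
  ... | no _  | no _  = refl

  irreflexive : ∀ (v : Fin s) → not ⌊ v Fin.≟ v ⌋ ≡ false
  irreflexive v with v Fin.≟ v
  ... | yes _ = refl
  ... | no ¬p = contradiction refl ¬p

-- G has a (not necessarily induced) subgraph isomorphic to H.
Contains : ∀ {k n} → Graph n → Graph k → Set
Contains {k} {n} G H =
  Σ (Fin k → Fin n) λ f → Injective _≡_ _≡_ f × (∀ u v → Edge H u v → Edge G (f u) (f v))

CliqueFree : ℕ → ∀ {n} → Graph n → Set
CliqueFree s G = ¬ Contains G (K s)

FarFromCliqueFree : ℕ → ℝ → ∀ {n} → Graph n → Set
FarFromCliqueFree s ε {n} G =
  ∀ (H : Graph n) → CliqueFree s H → seq ε *ˢ fromℕ (size G) ≤ˢ fromℕ (distance G H)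

-- Δ ≤ (α ε m)^(1/(s-2)), with both (nonnegative) sides raised to the power
-- s - 2; only used for s ≥ 3.
SmallMaxDegree : ℕ → ℝ → ℝ → ∀ {n} → Graph n → Set
SmallMaxDegree s α ε G =
  fromℕ (maxDegree G ^ (s ∸ 2)) ≤ˢ seq α *ˢ seq ε *ˢ fromℕ (size G)

------------------------------------------------------------------------
-- Uniform probability on finite sample spaces

-- An event is a Boolean function on the list of equally likely outcomes.
Pr : ∀ {A : Set} (Ω : List A) .{{_ : NonZero (length Ω)}} → (A → Bool) → ℚ
Pr Ω E = + length (filterᵇ E Ω) / length Ω

tuples : ∀ {A : Set} → List A → ∀ k → List (Vec A k)
tuples xs zero    = [] ∷ []
tuples xs (suc k) = cartesianProductWith _∷_ xs (tuples xs k)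

tuples-nonZero : ∀ {A : Set} (xs : List A) .{{_ : NonZero (length xs)}} k →
                 NonZero (length (tuples xs k))
tuples-nonZero xs       zero    = _
tuples-nonZero (x ∷ xs) (suc k) with tuples (x ∷ xs) k | tuples-nonZero (x ∷ xs) k
... | _ ∷ _ | _ = _

-- r independent fair coin tosses
coinTosses : ∀ r → List (Vec Bool r)
coinTosses = tuples (true ∷ false ∷ [])

-- r private coin tosses for each of n nodes
privateCoins : ∀ n r → List (Vec (Vec Bool r) n)
privateCoins n r = tuples (coinTosses r) n

privateCoins-nonZero : ∀ n r → NonZero (length (privateCoins n r))
privateCoins-nonZero n r =
  tuples-nonZero (coinTosses r) {{tuples-nonZero (true ∷ false ∷ []) r}} n

------------------------------------------------------------------------
-- The CONGEST model

-- A network on n nodes with ℓ-bit identifiers.  A node v addresses its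
-- incident edges by local port numbers Fin (degree v); the port numbering is
-- arbitrary, and the node does not initially know who is behind a port.
record Network (n ℓ : ℕ) : Set where
  field
    graph        : Graph n
    ident        : Fin n → Vec Bool ℓ
    ident-unique : Injective _≡_ _≡_ ident
    ports        : ∀ v → Fin (degree graph v) ↔ ∃ (Edge graph v)

  deg : Fin n → ℕ
  deg = degree graph

  neighbour : ∀ v → Fin (deg v) → Fin n
  neighbour v p = proj₁ (Inverse.to (ports v) p)

  -- the port under which the neighbour of v behind port p sees v
  backPort : ∀ v (p : Fin (deg v)) → Fin (deg (neighbour v p))
  backPort v p =
    let (u , e) = Inverse.to (ports v) p in Inverse.from (ports u) (v , Edge-sym graph e)

open Network public using (graph)

-- A message of at most B bits.
Message : ℕ → Set
Message B = Vec≤ Bool B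

-- The program executed by every node, with ℓ-bit identifiers and at most B
-- bits per message.  The argument d is the degree of the node executing it.
record Algorithm (ℓ B : ℕ) : Set₁ where
  field
    rounds : ℕ
    coins  : ℕ
    State  : (d : ℕ) → Set
    init   : ∀ d → Vec Bool ℓ → Vec Bool coins → State d
    send   : ∀ {d} → State d → Fin d → Message B
    update : ∀ {d} → State d → (Fin d → Message B) → State d
    accept : ∀ {d} → State d → Bool

open Algorithm public using (rounds; coins)

module Execution {n ℓ B} (A : Algorithm ℓ B) (N : Network n ℓ) where
  open Algorithm A hiding (rounds; coins)
  open Network N hiding (graph)

  Outcome : Set
  Outcome = Vec (Vec Bool (coins A)) n

  Configuration : Set
  Configuration = ∀ v → State (deg v)

  initial : Outcome → Configuration
  initial ω v = init (deg v) (ident v) (lookup ω v)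

  round : Configuration → Configuration
  round c v = update (c v) λ p → send (c (neighbour v p)) (backPort v p)

  after : ℕ → Configuration → Configuration
  after zero    c = c
  after (suc t) c = after t (round c)

  accepts : Outcome → Fin n → Bool
  accepts ω v = accept (after (rounds A) (initial ω) v)

  allAccept : Outcome → Bool
  allAccept ω = all (accepts ω) (allFin n)

  someRejects : Outcome → Bool
  someRejects ω = any (not ∘ accepts ω) (allFin n)

  Prob : (Outcome → Bool) → ℚ
  Prob = Pr (privateCoins n (coins A)) {{privateCoins-nonZero n (coins A)}}

open Execution public using (Prob; allAccept; someRejects)

------------------------------------------------------------------------
-- Property testing of clique-freeness on a class of graphs

module _ (s n : ℕ) {ℓ B : ℕ} (Class : Graph n → Set) (A : Algorithm ℓ B) where

  -- An edgeless graph is vacuously ε-far from every property (0 ≥ ε · 0),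
  -- including those it has, so the second clause is restricted to graphs
  -- with at least one edge.
  IsTester : ℝ → Set
  IsTester ε =
    (∀ (N : Network n ℓ) → Class (graph N) → CliqueFree s (graph N) →
       + 2 / 3 ≤ Prob A N (allAccept A N)) ×
    (∀ (N : Network n ℓ) → Class (graph N) → 1 ℕ.≤ size (graph N) →
       FarFromCliqueFree s ε (graph N) →
       + 2 / 3 ≤ Prob A N (someRejects A N))

  HasOneSidedError : Set
  HasOneSidedError =
    ∀ (N : Network n ℓ) → Class (graph N) → CliqueFree s (graph N) →
      Prob A N (allAccept A N) ≡ 1ℚ

-- A CONGEST algorithm with identifiers of c ⌈log₂ n⌉ bits and messages
-- of at most b ⌈log₂ n⌉ bits; n and the parameter ε are known to the nodes.
CongestAlgorithm : (c b : ℕ) → Set₁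
CongestAlgorithm c b = (n : ℕ) → ℝ → Algorithm (c ℕ.* ⌈log₂ n ⌉) (b ℕ.* ⌈log₂ n ⌉)

{-# OPTIONS --safe #-}

-- Let t = s - 2.  Every node draws a constant number of t-tuples of its ports
-- and rejects if the sampled neighbours, together with itself and some further
-- neighbour, form a clique; three rounds suffice to check this.
--
-- Scan all s-tuples of vertices and, whenever one is a clique of the current
-- graph, delete one fixed edge of it.  The p cliques met this way have
-- distinct deleted edges, and the remaining graph is K_s-free, so p ≥ ε m up
-- to a constant if the graph is ε-far.  If the deleted edge joins the vertex
-- number 0 to a vertex among the last t, then the events "vertex number 0 of
-- the clique draws the last t vertices", each of probability about Δ^(-t), are
-- disjoint for cliques with the same vertex number 0.  Hence the success
-- probabilities of the nodes sum to at least about p Δ^(-t), which is bounded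
-- below because Δ^t ≤ α ε m.  As the nodes are independent, a constant number
-- of repetitions brings the probability that all of them fail below 1/3.
module Submission where

import Algebra.Properties.CommutativeMonoid.Sum
open import Data.Bool.Base using (Bool; true; false; T; not; _∧_; _∨_; _xor_; if_then_else_)
open import Data.Bool.ListAction using (any)
import Data.Bool.Properties as Bool
open import Data.Bool.Properties using (T-∧; T-∨; ∧-comm; ∨-comm)
open import Data.Empty using (⊥; ⊥-elim)
open import Data.Fin.Base using (Fin; zero; suc; toℕ)
import Data.Fin.Properties as Fin
import Data.Integer.Base as ℤ
import Data.Integer.Properties as ℤ
open import Data.List.Base as List
  using (List; []; _∷_; length; filterᵇ; allFin; cartesianProduct; cartesianProductWith)
open import Data.List.Extrema.Nat using (xs≤max)
open import Data.List.Membership.Propositional using (_∈_)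
open import Data.List.Membership.Propositional.Properties
  using (∈-cartesianProductWith⁺; ∈-upTo⁺; ∈-allFin; ∈-map⁺)
open import Data.List.Properties
  using ( length-map; length-++; length-filter; length-tabulate; map-++; map-∘; map-id; map-applyUpTo
        ; ++-identityʳ; cartesianProductWith-distribʳ-++; filter-some; filter-none)
open import Data.List.Relation.Unary.All as All using (All; []; _∷_)
open import Data.List.Relation.Unary.All.Properties using (all⁻)
open import Data.List.Relation.Unary.AllPairs using (AllPairs; []; _∷_)
open import Data.List.Relation.Unary.Any as Any using (Any; here)
open import Data.List.Relation.Unary.Any.Properties using (any⁺; any⁻)
open import Data.List.Relation.Unary.Unique.Propositional using (Unique)
open import Data.List.Relation.Unary.Unique.Propositional.Properties using (allFin⁺)
open import Data.Nat.Base
open import Data.Nat.DivMod hiding (_/_)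
open import Data.Nat.Logarithm using (⌈log₂_⌉; ⌈log₂⌉-mono-≤)
open import Data.Nat.Properties
open import Data.Nat.Tactic.RingSolver using (solve-∀)
open import Data.Product.Base using (Σ; ∃; ∃-syntax; _×_; _,_; proj₁; proj₂)
open import Data.Product.Properties using (,-injective)
open import Data.Rational.Base as ℚ using (ℚ; mkℚ; 0ℚ; 1ℚ; toℚᵘ; fromℚᵘ; ↥_)
import Data.Rational.Properties as ℚ
open import Data.Rational.Unnormalised.Base as ℚᵘ using (mkℚᵘ; *≡*; *≤*)
import Data.Rational.Unnormalised.Properties as ℚᵘ
open import Data.Sum.Base using (inj₁; inj₂)
open import Data.Unit.Base using (tt)
open import Data.Vec.Base as Vec
  using (Vec; []; _∷_; lookup; _++_; take; drop; concat; tabulate; replicate)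
open import Data.Vec.Bounded.Base using () renaming (_,_ to _⟨≤⟩_)
open import Data.Vec.Functional using (foldr)
import Data.Vec.Properties as Vec
open import Data.Vec.Properties
  using (++-injective; take++drop≡id; lookup∘tabulate; lookup-map; ≡-dec)
open import Function.Base using (_∘_)
open import Function.Bundles using (Equivalence; Inverse; _⇔_; mk⇔)
open import Relation.Binary.PropositionalEquality
open import Relation.Nullary using (¬_; Dec; yes; no; contradiction; T?; ¬?)
open import Relation.Nullary.Decidable
  using (⌊_⌋; toWitness; fromWitness; toWitnessFalse; fromWitnessFalse; _→-dec_; _×-dec_)
open import Defs

open Algebra.Properties.CommutativeMonoid.Sum +-0-commutativeMonoid using (sum; ∑-distrib-+)
open Algebra.Properties.CommutativeMonoid.Sum *-1-commutativeMonoid using () renaming (sum to product)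

private variable
  A C D : Set
  k r s t ℓ m n B : ℕ

-- Booleans and counting in lists.

T-not : ∀ {b} → T (not b) → ¬ T b
T-not {false} _ ()

count : (A → Bool) → List A → ℕ
count p xs = length (filterᵇ p xs)

𝟙 : Bool → ℕ
𝟙 b = if b then 1 else 0

count-∷ : ∀ (p : A → Bool) x xs → count p (x ∷ xs) ≡ 𝟙 (p x) + count p xs
count-∷ p x xs with p x
... | true  = refl
... | false = refl

count-mono : ∀ {p q : A → Bool} → (∀ x → T (p x) → T (q x)) → ∀ xs → count p xs ≤ count q xs
count-mono p⇒q []       = z≤n
count-mono {p = p} {q} p⇒q (x ∷ xs) with p x | q x | p⇒q x
... | false | false | _ = count-mono p⇒q xs
... | false | true  | _ = m≤n⇒m≤1+n (count-mono p⇒q xs)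
... | true  | false | f = ⊥-elim (f tt)
... | true  | true  | _ = s≤s (count-mono p⇒q xs)

count-none : ∀ {p : A → Bool} → (∀ x → ¬ T (p x)) → ∀ xs → count p xs ≡ 0
count-none ¬p []       = refl
count-none {p = p} ¬p (x ∷ xs) with p x | ¬p x
... | false | _  = count-none ¬p xs
... | true  | ¬t = contradiction tt ¬t

count-∨-∧ : ∀ (p q : A → Bool) xs →
  count (λ x → p x ∨ q x) xs + count (λ x → p x ∧ q x) xs ≡ count p xs + count q xs
count-∨-∧ p q []       = refl
count-∨-∧ p q (x ∷ xs) with p x | q x | count-∨-∧ p q xs
... | false | false | ih = ih
... | false | true  | ih = trans (cong suc ih) (sym (+-suc _ _))
... | true  | false | ih = cong suc ih
... | true  | true  | ih = cong suc (trans (+-suc _ _) (trans (cong suc ih) (sym (+-suc _ _))))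

count-∨ : ∀ (p q : A → Bool) xs → count (λ x → p x ∨ q x) xs ≤ count p xs + count q xs
count-∨ p q xs = ≤-trans (m≤m+n _ _) (≤-reflexive (count-∨-∧ p q xs))

count-disjoint : ∀ {p q : A → Bool} → (∀ x → T (p x) → T (q x) → ⊥) → ∀ xs →
  count p xs + count q xs ≡ count (λ x → p x ∨ q x) xs
count-disjoint {p = p} {q} disj xs = begin
  count p xs + count q xs                                     ≡⟨ count-∨-∧ p q xs ⟨
  count (λ x → p x ∨ q x) xs + count (λ x → p x ∧ q x) xs
    ≡⟨ cong (count (λ x → p x ∨ q x) xs +_)
         (count-none (λ x t → let (a , b) = Equivalence.to T-∧ t in disj x a b) xs) ⟩
  count (λ x → p x ∨ q x) xs + 0                              ≡⟨ +-identityʳ _ ⟩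
  count (λ x → p x ∨ q x) xs                                  ∎
  where open ≡-Reasoning

count-not : ∀ (p : A → Bool) xs → count p xs + count (not ∘ p) xs ≡ length xs
count-not p []       = refl
count-not p (x ∷ xs) with p x | count-not p xs
... | false | ih = trans (+-suc _ _) (cong suc ih)
... | true  | ih = cong suc ih

count-all : ∀ {p : A → Bool} → (∀ x → T (p x)) → ∀ xs → count p xs ≡ length xs
count-all pt []       = refl
count-all {p = p} pt (x ∷ xs) with p x | pt x
... | true | _ = cong suc (count-all pt xs)

count-map : ∀ (p : C → Bool) (f : A → C) xs → count p (List.map f xs) ≡ count (p ∘ f) xs
count-map p f []       = refl
count-map p f (x ∷ xs) with p (f x)
... | true  = cong suc (count-map p f xs)
... | false = count-map p f xs

count-++ : ∀ (p : A → Bool) xs ys → count p (xs List.++ ys) ≡ count p xs + count p ys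
count-++ p []       ys = refl
count-++ p (x ∷ xs) ys with p x
... | true  = cong suc (count-++ p xs ys)
... | false = count-++ p xs ys

-- Independence of two events in counting form: a row `x` contributes the count of `q` if `p x`
-- holds and nothing otherwise.
count-cartesianProductWith : ∀ (f : A → C → D) (p : A → Bool) (q : C → Bool) {r : D → Bool} →
  (∀ x y → r (f x y) ≡ p x ∧ q y) → ∀ xs ys →
  count r (cartesianProductWith f xs ys) ≡ count p xs * count q ys
count-cartesianProductWith f p q     r≗ []       ys = refl
count-cartesianProductWith f p q {r} r≗ (x ∷ xs) ys = begin
  count r (List.map (f x) ys List.++ cartesianProductWith f xs ys)
    ≡⟨ count-++ r (List.map (f x) ys) _ ⟩
  count r (List.map (f x) ys) + count r (cartesianProductWith f xs ys)
    ≡⟨ cong₂ _+_ (trans (count-map r (f x) ys) (row ys)) (count-cartesianProductWith f p q r≗ xs ys) ⟩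
  𝟙 (p x) * count q ys + count p xs * count q ys
    ≡⟨ *-distribʳ-+ (count q ys) (𝟙 (p x)) (count p xs) ⟨
  (𝟙 (p x) + count p xs) * count q ys
    ≡⟨ cong (_* count q ys) (count-∷ p x xs) ⟨
  count p (x ∷ xs) * count q ys ∎
  where
  open ≡-Reasoning
  row : ∀ zs → count (r ∘ f x) zs ≡ 𝟙 (p x) * count q zs
  row []       = sym (*-zeroʳ (𝟙 (p x)))
  row (z ∷ zs) = begin
    count (r ∘ f x) (z ∷ zs)                       ≡⟨ count-∷ (r ∘ f x) z zs ⟩
    𝟙 (r (f x z)) + count (r ∘ f x) zs             ≡⟨ cong₂ (λ b k → 𝟙 b + k) (r≗ x z) (row zs) ⟩
    𝟙 (p x ∧ q z) + 𝟙 (p x) * count q zs           ≡⟨ cong (_+ 𝟙 (p x) * count q zs) (𝟙-∧ (p x) (q z)) ⟩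
    𝟙 (p x) * 𝟙 (q z) + 𝟙 (p x) * count q zs       ≡⟨ *-distribˡ-+ (𝟙 (p x)) _ _ ⟨
    𝟙 (p x) * (𝟙 (q z) + count q zs)               ≡⟨ cong (𝟙 (p x) *_) (count-∷ q z zs) ⟨
    𝟙 (p x) * count q (z ∷ zs)                     ∎
    where
    𝟙-∧ : ∀ a b → 𝟙 (a ∧ b) ≡ 𝟙 a * 𝟙 b
    𝟙-∧ true  b = sym (+-identityʳ _)
    𝟙-∧ false b = refl

-- Finite sums, products and conjunctions

⋀ : (Fin n → Bool) → Bool
⋀ = foldr _∧_ true

⋀⁺ : ∀ {b : Fin n → Bool} → (∀ i → T (b i)) → T (⋀ b)
⋀⁺ {zero}  t = tt
⋀⁺ {suc n} t = Equivalence.from T-∧ (t zero , ⋀⁺ (t ∘ suc))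

⋀⁻ : ∀ {b : Fin n → Bool} → T (⋀ b) → ∀ i → T (b i)
⋀⁻ t zero    = proj₁ (Equivalence.to T-∧ t)
⋀⁻ t (suc i) = ⋀⁻ (proj₂ (Equivalence.to T-∧ t)) i

sum-mono : ∀ {f g : Fin n → ℕ} → (∀ i → f i ≤ g i) → sum f ≤ sum g
sum-mono {zero}  f≤g = z≤n
sum-mono {suc n} f≤g = +-mono-≤ (f≤g zero) (sum-mono (f≤g ∘ suc))

term≤sum : ∀ (f : Fin n → ℕ) i → f i ≤ sum f
term≤sum f zero    = m≤m+n _ _
term≤sum f (suc i) = ≤-trans (term≤sum (f ∘ suc) i) (m≤n+m _ _)

sum-*ˡ : ∀ c (f : Fin n → ℕ) → sum (λ i → c * f i) ≡ c * sum f
sum-*ˡ {zero}  c f = sym (*-zeroʳ c)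
sum-*ˡ {suc n} c f = trans (cong (c * f zero +_) (sum-*ˡ c (f ∘ suc))) (sym (*-distribˡ-+ c _ _))

sum-const : ∀ c → sum {n} (λ _ → c) ≡ n * c
sum-const {zero}  c = refl
sum-const {suc n} c = cong (c +_) (sum-const {n} c)

-- With denominators cleared: independent events of probability at least `1 / c` each all occur with
-- probability at least `1 / c ^ n`.
^≤product*^ : ∀ (f : Fin n → ℕ) {b c} → (∀ i → b ≤ f i * c) → b ^ n ≤ product f * c ^ n
^≤product*^ {zero}  f         b≤ = ≤-refl
^≤product*^ {suc n} f {b} {c} b≤ = begin
  b * b ^ n                                ≤⟨ *-mono-≤ (b≤ zero) (^≤product*^ (f ∘ suc) (b≤ ∘ suc)) ⟩
  f zero * c * (product (f ∘ suc) * c ^ n) ≡⟨ rearrange (f zero) c (product (f ∘ suc)) (c ^ n) ⟩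
  product f * c ^ suc n                    ∎
  where
  open ≤-Reasoning
  rearrange : ∀ x y z w → x * y * (z * w) ≡ x * z * (y * w)
  rearrange = solve-∀

-- If φᵢ ≤ 1 / (1 + xᵢ) for all i, then Π φᵢ ≤ 1 / (1 + Σ xᵢ); stated for
-- φᵢ = fᵢ / T and xᵢ = aᵢ / M with the denominators cleared.
product*[M+sum]≤ : ∀ {M T} .{{_ : NonZero M}} (f a : Fin n → ℕ) →
  (∀ i → f i * (M + a i) ≤ T * M) → product f * (M + sum a) ≤ T ^ n * M
product*[M+sum]≤ {zero}  {M}     f a f≤ = ≤-reflexive (cong (1 *_) (+-identityʳ M))
product*[M+sum]≤ {suc n} {M} {T} f a f≤ = *-cancelʳ-≤ _ _ M (begin
  -- The factor `(M + a₀) * (M + S)` exceeds `M * (M + (a₀ + S))` by `a₀ * S`; adding this surplus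
  -- makes the left side factor, and the extra factor `M` is cancelled at the end.
  f₀ * Π * (M + (a₀ + S)) * M               ≤⟨ m≤m+n _ _ ⟩
  f₀ * Π * (M + (a₀ + S)) * M + f₀ * Π * a₀ * S ≡⟨ expand f₀ Π a₀ S M ⟩
  f₀ * (M + a₀) * (Π * (M + S))             ≤⟨ *-mono-≤ (f≤ zero) (product*[M+sum]≤ (f ∘ suc) (a ∘ suc) (f≤ ∘ suc)) ⟩
  T * M * (T ^ n * M)                       ≡⟨ collect T M (T ^ n) ⟩
  T * T ^ n * M * M                         ∎)
  where
  open ≤-Reasoning
  f₀ = f zero
  a₀ = a zero
  Π = product (f ∘ suc)
  S = sum (a ∘ suc)
  expand : ∀ f₀ Π a₀ S M →
    f₀ * Π * (M + (a₀ + S)) * M + f₀ * Π * a₀ * S ≡ f₀ * (M + a₀) * (Π * (M + S))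
  expand = solve-∀
  collect : ∀ T M U → T * M * (U * M) ≡ T * U * M * M
  collect = solve-∀

-- Counting tuples

length-cartesianProductWith : ∀ (f : A → C → D) xs ys →
  length (cartesianProductWith f xs ys) ≡ length xs * length ys
length-cartesianProductWith f []       ys = refl
length-cartesianProductWith f (x ∷ xs) ys =
  trans (length-++ (List.map (f x) ys)) (cong₂ _+_ (length-map (f x) ys) (length-cartesianProductWith f xs ys))

length-tuples : ∀ (xs : List A) k → length (tuples xs k) ≡ length xs ^ k
length-tuples xs zero    = refl
length-tuples xs (suc k) =
  trans (length-cartesianProductWith _∷_ xs (tuples xs k)) (cong (length xs *_) (length-tuples xs k))

-- Independence of the coordinates. It serves at three levels: the `t` ports of a draw, the `k`
-- draws of a node, and the `n` nodes.
count-tuples : ∀ (xs : List A) (p : Fin n → A → Bool) →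
  count (λ v → ⋀ λ i → p i (lookup v i)) (tuples xs n) ≡ product λ i → count (p i) xs
count-tuples {n = zero}  xs p = refl
count-tuples {n = suc n} xs p =
  trans (count-cartesianProductWith _∷_ (p zero) (λ v → ⋀ λ i → p (suc i) (lookup v i)) (λ _ _ → refl) xs (tuples xs n))
        (cong (count (p zero) xs *_) (count-tuples xs (p ∘ suc)))

-- Cutting tuples into blocks.

chunks : ∀ k r → Vec A (k * r) → Vec (Vec A r) k
chunks zero    r xs = []
chunks (suc k) r xs = take r xs ∷ chunks k r (drop r xs)

take-drop-++ : ∀ (xs : Vec A m) (ys : Vec A n) → take m (xs ++ ys) ≡ xs × drop m (xs ++ ys) ≡ ys
take-drop-++ {m = m} xs ys = ++-injective (take m (xs ++ ys)) xs (take++drop≡id m (xs ++ ys))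

chunks-concat : ∀ {k r} (xss : Vec (Vec A r) k) → chunks k r (concat xss) ≡ xss
chunks-concat []         = refl
chunks-concat (xs ∷ xss) =
  let (t , d) = take-drop-++ xs (concat xss) in
  cong₂ _∷_ t (trans (cong (chunks _ _) d) (chunks-concat xss))

map-cartesianProductWith : ∀ {B E : Set} (g : D → E) (f : A → C → D) (h : A → B → E) (φ : C → B) →
  (∀ x y → g (f x y) ≡ h x (φ y)) → ∀ xs ys →
  List.map g (cartesianProductWith f xs ys) ≡ cartesianProductWith h xs (List.map φ ys)
map-cartesianProductWith g f h φ eq []       ys = refl
map-cartesianProductWith g f h φ eq (x ∷ xs) ys =
  trans (map-++ g (List.map (f x) ys) _)
        (cong₂ List._++_ (row ys) (map-cartesianProductWith g f h φ eq xs ys))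
  where
  row : ∀ zs → List.map g (List.map (f x) zs) ≡ List.map (h x) (List.map φ zs)
  row []       = refl
  row (z ∷ zs) = cong₂ _∷_ (eq x z) (row zs)

cartesianProductWith-assoc : ∀ {B E F : Set} (f : A → F → D) (g : B → C → F) (h : A → B → E) (j : E → C → D) →
  (∀ x y z → f x (g y z) ≡ j (h x y) z) → ∀ xs ys zs →
  cartesianProductWith f xs (cartesianProductWith g ys zs) ≡
  cartesianProductWith j (cartesianProductWith h xs ys) zs
cartesianProductWith-assoc f g h j eq []       ys zs = refl
cartesianProductWith-assoc f g h j eq (x ∷ xs) ys zs =
  trans (cong₂ List._++_ (row ys) (cartesianProductWith-assoc f g h j eq xs ys zs))
        (sym (distrib (List.map (h x) ys)))
  where
  single : ∀ y ws → List.map (f x) (List.map (g y) ws) ≡ List.map (j (h x y)) ws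
  single y []       = refl
  single y (w ∷ ws) = cong₂ _∷_ (eq x y w) (single y ws)
  row : ∀ ys → List.map (f x) (cartesianProductWith g ys zs) ≡ cartesianProductWith j (List.map (h x) ys) zs
  row []       = refl
  row (y ∷ ys) = trans (map-++ (f x) (List.map (g y) zs) _) (cong₂ List._++_ (single y zs) (row ys))
  distrib : ∀ us {vs} → cartesianProductWith j (us List.++ vs) zs ≡
            cartesianProductWith j us zs List.++ cartesianProductWith j vs zs
  distrib us {vs} = cartesianProductWith-distribʳ-++ j us vs zs

tuples-++ : ∀ (xs : List A) m n →
  tuples xs (m + n) ≡ cartesianProductWith _++_ (tuples xs m) (tuples xs n)
tuples-++ xs zero    n = sym (trans (++-identityʳ _) (map-id _))
tuples-++ xs (suc m) n =
  trans (cong (cartesianProductWith _∷_ xs) (tuples-++ xs m n))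
        (cartesianProductWith-assoc _∷_ _++_ _∷_ _++_ (λ _ _ _ → refl) xs (tuples xs m) (tuples xs n))

-- Both sides are in lexicographic order, so they agree as lists and not merely up to permutation.
-- Hence a block of coins may be treated as several independent blocks.
map-chunks-tuples : ∀ (xs : List A) k r →
  List.map (chunks k r) (tuples xs (k * r)) ≡ tuples (tuples xs r) k
map-chunks-tuples xs zero    r = refl
map-chunks-tuples xs (suc k) r = trans (cong (List.map (chunks (suc k) r)) (tuples-++ xs r (k * r)))
  (trans (map-cartesianProductWith (chunks (suc k) r) _++_ _∷_ (chunks k r)
           (λ y z → let (t , d) = take-drop-++ y z in cong₂ _∷_ t (cong (chunks k r) d))
           (tuples xs r) (tuples xs (k * r)))
         (cong (cartesianProductWith _∷_ (tuples xs r)) (map-chunks-tuples xs k r)))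

count-chunks : ∀ (xs : List A) k r (p : Vec (Vec A r) k → Bool) →
  count (p ∘ chunks k r) (tuples xs (k * r)) ≡ count p (tuples (tuples xs r) k)
count-chunks xs k r p =
  trans (sym (count-map p (chunks k r) (tuples xs (k * r)))) (cong (count p) (map-chunks-tuples xs k r))

∈-tuples : ∀ {xs : List A} → (∀ x → x ∈ xs) → ∀ (v : Vec A n) → v ∈ tuples xs n
∈-tuples all∈ []      = here refl
∈-tuples all∈ (x ∷ v) =
  ∈-cartesianProductWith⁺ _∷_ (all∈ x) (∈-tuples all∈ v)

-- Almost uniform choice from coin tosses

applyUpTo-++ : ∀ (f : ℕ → A) m n → List.applyUpTo f (m + n) ≡ List.applyUpTo f m List.++ List.applyUpTo (f ∘ (m +_)) n
applyUpTo-++ f zero    n = refl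
applyUpTo-++ f (suc m) n = cong (f 0 ∷_) (applyUpTo-++ (f ∘ suc) m n)

-- The most significant bit comes first and `true` is the digit 0, because `coinTosses` lists `true`
-- before `false`; the outcomes are then read as 0, 1, 2, ... in order.
binary : Vec Bool n → ℕ
binary []                  = 0
binary (true ∷ v)          = binary v
binary {suc n} (false ∷ v) = 2 ^ n + binary v

map-binary-coinTosses : ∀ r → List.map binary (coinTosses r) ≡ List.upTo (2 ^ r)
map-binary-coinTosses zero    = refl
map-binary-coinTosses (suc r) = begin
  List.map binary (List.map (true ∷_) vs List.++ List.map (false ∷_) vs List.++ [])
    ≡⟨ cong (λ ws → List.map binary (List.map (true ∷_) vs List.++ ws)) (++-identityʳ (List.map (false ∷_) vs)) ⟩
  List.map binary (List.map (true ∷_) vs List.++ List.map (false ∷_) vs)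
    ≡⟨ map-++ binary (List.map (true ∷_) vs) _ ⟩
  List.map binary (List.map (true ∷_) vs) List.++ List.map binary (List.map (false ∷_) vs)
    ≡⟨ cong₂ List._++_ (sym (map-∘ vs)) (trans (sym (map-∘ vs)) (map-∘ vs)) ⟩
  List.map binary vs List.++ List.map (2 ^ r +_) (List.map binary vs)
    ≡⟨ cong (λ xs → xs List.++ List.map (2 ^ r +_) xs) (map-binary-coinTosses r) ⟩
  List.upTo (2 ^ r) List.++ List.map (2 ^ r +_) (List.upTo (2 ^ r))
    ≡⟨ cong (List.upTo (2 ^ r) List.++_) (map-applyUpTo (λ x → x) (2 ^ r +_) (2 ^ r)) ⟩
  List.upTo (2 ^ r) List.++ List.applyUpTo (2 ^ r +_) (2 ^ r)
    ≡⟨ applyUpTo-++ (λ x → x) (2 ^ r) (2 ^ r) ⟨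
  List.upTo (2 ^ r + 2 ^ r)
    ≡⟨ cong (λ k → List.upTo (2 ^ r + k)) (+-identityʳ (2 ^ r)) ⟨
  List.upTo (2 ^ suc r) ∎
  where
  open ≡-Reasoning
  vs = coinTosses r

length-coinTosses : ∀ r → length (coinTosses r) ≡ 2 ^ r
length-coinTosses = length-tuples (true ∷ false ∷ [])

-- Each of the `q` full periods contains at least as many hits as the first one; the incomplete
-- period of length `e` only adds to the count.
periodic-count : ∀ (p : ℕ → Bool) d → (∀ x → T (p x) → T (p (d + x))) → ∀ q e →
  q * count p (List.upTo d) ≤ count p (List.upTo (q * d + e))
periodic-count p d per zero    e = z≤n
periodic-count p d per (suc q) e = begin
  count p (List.upTo d) + q * count p (List.upTo d)
    ≤⟨ +-monoʳ-≤ _ (periodic-count p d per q e) ⟩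
  count p (List.upTo d) + count p (List.upTo (q * d + e))
    ≤⟨ +-monoʳ-≤ _ (count-mono per (List.upTo (q * d + e))) ⟩
  count p (List.upTo d) + count (p ∘ (d +_)) (List.upTo (q * d + e))
    ≡⟨ cong (count p (List.upTo d) +_) (count-map p (d +_) (List.upTo (q * d + e))) ⟨
  count p (List.upTo d) + count p (List.map (d +_) (List.upTo (q * d + e)))
    ≡⟨ cong (λ xs → count p (List.upTo d) + count p xs) (map-applyUpTo (λ x → x) (d +_) (q * d + e)) ⟩
  count p (List.upTo d) + count p (List.applyUpTo (d +_) (q * d + e))
    ≡⟨ count-++ p (List.upTo d) _ ⟨
  count p (List.upTo d List.++ List.applyUpTo (d +_) (q * d + e))
    ≡⟨ cong (count p) (applyUpTo-++ (λ x → x) d (q * d + e)) ⟨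
  count p (List.upTo (d + (q * d + e)))
    ≡⟨ cong (count p ∘ List.upTo) (+-assoc d (q * d) e) ⟨
  count p (List.upTo (d + q * d + e)) ∎
  where open ≤-Reasoning

count-some : ∀ {p : A → Bool} {x xs} → x ∈ xs → T (p x) → 1 ≤ count p xs
count-some {p = p} x∈xs px = filter-some (T? ∘ p) (Any.map (λ { refl → px }) x∈xs)

pick : ∀ {d r} .{{_ : NonZero d}} → Vec Bool r → Fin d
pick {d} bits = binary bits mod d

-- Reduction modulo `d` is not exactly uniform, but every residue has at least `q = 2 ^ r / d`
-- preimages. Since `q ≥ 1`, the remainder is at most `q * d`, so `2 ^ r ≤ 2 * q * d` and each port
-- has probability at least `1 / (2 * d)`.
2^r≤count-pick : ∀ {d r} .{{_ : NonZero d}} → d ≤ 2 ^ r → (i : Fin d) →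
  2 ^ r ≤ count (λ bits → ⌊ pick bits Fin.≟ i ⌋) (coinTosses r) * (2 * d)
2^r≤count-pick {d} {r} d≤2^r i = begin
  2 ^ r                                    ≡⟨ m≡m%n+[m/n]*n (2 ^ r) d ⟩
  2 ^ r % d + q * d                        ≤⟨ +-monoˡ-≤ (q * d) (≤-trans (m%n≤n (2 ^ r) d) (m≤n*m d q)) ⟩
  q * d + q * d                            ≡⟨ double q d ⟩
  q * 1 * (2 * d)                          ≤⟨ *-monoˡ-≤ (2 * d) (*-monoʳ-≤ q (count-some (∈-upTo⁺ (Fin.toℕ<n i)) hit)) ⟩
  q * count p (List.upTo d) * (2 * d)      ≤⟨ *-monoˡ-≤ (2 * d) (periodic-count p d periodic q (2 ^ r % d)) ⟩
  count p (List.upTo (q * d + 2 ^ r % d)) * (2 * d)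
    ≡⟨ cong (λ k → count p (List.upTo k) * (2 * d)) (trans (+-comm (q * d) _) (sym (m≡m%n+[m/n]*n (2 ^ r) d))) ⟩
  count p (List.upTo (2 ^ r)) * (2 * d)    ≡⟨ cong (λ xs → count p xs * (2 * d)) (map-binary-coinTosses r) ⟨
  count p (List.map binary (coinTosses r)) * (2 * d)
    ≡⟨ cong (_* (2 * d)) (count-map p binary (coinTosses r)) ⟩
  count (λ bits → ⌊ pick bits Fin.≟ i ⌋) (coinTosses r) * (2 * d) ∎
  where
  open ≤-Reasoning
  q = 2 ^ r / d
  instance
    q≢0 : NonZero q
    q≢0 = >-nonZero (m≥n⇒m/n>0 d≤2^r)
  p : ℕ → Bool
  p x = ⌊ x mod d Fin.≟ i ⌋
  periodic : ∀ x → T (p x) → T (p (d + x))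
  periodic x t = fromWitness (trans
    (Fin.fromℕ<-cong _ _ (trans (cong (_% d) (+-comm d x)) ([m+n]%n≡m%n x d)) _ _)
    (toWitness t))
  hit : T (p (toℕ i))
  hit = fromWitness (trans
    (Fin.fromℕ<-cong _ _ (m<n⇒m%n≡m (Fin.toℕ<n i)) _ (Fin.toℕ<n i))
    (Fin.fromℕ<-toℕ i (Fin.toℕ<n i)))
  double : ∀ q d → q * d + q * d ≡ q * 1 * (2 * d)
  double = solve-∀

-- Packings of cliques

Edge⇒≢ : ∀ (G : Graph n) {u v} → Edge G u v → u ≢ v
Edge⇒≢ G {u} e refl = subst T (irrefl G u) e

-- Only the positions are required to differ: as graphs are irreflexive, the adjacency then forces
-- the entries to be distinct.
Clique : Graph n → Vec (Fin n) s → Set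
Clique G x = ∀ i j → i ≢ j → Edge G (lookup x i) (lookup x j)

clique? : ∀ (G : Graph n) (x : Vec (Fin n) s) → Dec (Clique G x)
clique? G x = Fin.all? λ i → Fin.all? λ j → ¬? (i Fin.≟ j) →-dec T? _

contains-clique : ∀ (G : Graph n) (f : Fin s → Fin n) →
  (∀ i j → i ≢ j → Edge G (f i) (f j)) → Contains G (K s)
contains-clique G f adjacent = f , injective , λ u v e → adjacent u v (toWitnessFalse e)
  where
  injective : ∀ {i j} → f i ≡ f j → i ≡ j
  injective {i} {j} fi≡fj with i Fin.≟ j
  ... | yes i≡j = i≡j
  ... | no  i≢j = contradiction fi≡fj (Edge⇒≢ G (adjacent i j i≢j))

no-clique⇒cliqueFree : ∀ (G : Graph n) → (∀ (x : Vec (Fin n) s) → ¬ Clique G x) → CliqueFree s G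
no-clique⇒cliqueFree G ¬clique (f , _ , hom) = ¬clique (Vec.tabulate f) λ i j i≢j →
  subst₂ (Edge G) (sym (lookup∘tabulate f i)) (sym (lookup∘tabulate f j)) (hom i j (fromWitnessFalse i≢j))

distance-triangle : ∀ (G H I : Graph n) → distance G I ≤ distance G H + distance H I
distance-triangle {n} G H I = ≤-trans
  (count-mono (λ (u , v) → triangle ⌊ u Fin.<? v ⌋ (adj G u v) (adj H u v) (adj I u v)) pairs)
  (count-∨ (λ (u , v) → ⌊ u Fin.<? v ⌋ ∧ (adj G u v xor adj H u v))
           (λ (u , v) → ⌊ u Fin.<? v ⌋ ∧ (adj H u v xor adj I u v)) pairs)
  where
  pairs = cartesianProduct (allFin n) (allFin n)
  triangle : ∀ l a b c → T (l ∧ (a xor c)) → T ((l ∧ (a xor b)) ∨ (l ∧ (b xor c)))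
  triangle true false false true  _ = tt
  triangle true false true  true  _ = tt
  triangle true true  false false _ = tt
  triangle true true  true  false _ = tt

distance-refl : ∀ (G : Graph n) → distance G G ≡ 0
distance-refl {n} G = count-none (λ (u , v) → ¬xor (adj G u v) ∘ proj₂ ∘ Equivalence.to T-∧)
  (cartesianProduct (allFin n) (allFin n))
  where
  ¬xor : ∀ a → ¬ T (a xor a)
  ¬xor true  ()
  ¬xor false ()

count-≟≤1 : ∀ (a : Fin n) {xs} → Unique xs → count (λ x → ⌊ x Fin.≟ a ⌋) xs ≤ 1
count-≟≤1 a [] = z≤n
count-≟≤1 a {x ∷ xs} (x∉xs ∷ u) with x Fin.≟ a
... | no  _    = count-≟≤1 a u
... | yes refl = ≤-reflexive (cong (suc ∘ length)
  (filter-none (λ y → T? ⌊ y Fin.≟ a ⌋) (All.map (λ x≢y t → x≢y (sym (toWitness t))) x∉xs)))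

module _ (G : Graph n) (a b : Fin n) where

  private
    is : Fin n → Fin n → Fin n → Fin n → Bool
    is a b u v = ⌊ u Fin.≟ a ⌋ ∧ ⌊ v Fin.≟ b ⌋

    removed : Fin n → Fin n → Bool
    removed u v = is a b u v ∨ is a b v u

    is-refl : T (is a b a b)
    is-refl = Equivalence.from (T-∧ {⌊ a Fin.≟ a ⌋} {⌊ b Fin.≟ b ⌋})
      (fromWitness {a? = a Fin.≟ a} refl , fromWitness {a? = b Fin.≟ b} refl)

  removeEdge : Graph n
  removeEdge = record
    { adj    = λ u v → adj G u v ∧ not (removed u v)
    ; symm   = λ u v → cong₂ (λ e r → e ∧ not r) (symm G u v) (∨-comm (is a b u v) (is a b v u))
    ; irrefl = λ v → cong (_∧ not (removed v v)) (irrefl G v)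
    }

  removeEdge⊆ : ∀ {u v} → Edge removeEdge u v → Edge G u v
  removeEdge⊆ = proj₁ ∘ Equivalence.to T-∧

  removeEdge-removes : ¬ Edge removeEdge a b
  removeEdge-removes e = T-not (proj₂ (Equivalence.to T-∧ e)) (Equivalence.from T-∨ (inj₁ is-refl))

  -- The bound is 2 and not 1 because both orientations of the deleted pair are counted; this costs
  -- only a constant factor.
  distance-removeEdge : distance G removeEdge ≤ 2
  distance-removeEdge = begin
    distance G removeEdge
      ≤⟨ count-mono (λ (u , v) t → xor⇒removed (adj G u v) (removed u v) (proj₂ (Equivalence.to T-∧ t))) pairs ⟩
    count (λ (u , v) → removed u v) pairs
      ≤⟨ count-∨ (λ (u , v) → is a b u v) (λ (u , v) → is a b v u) pairs ⟩
    count (λ (u , v) → is a b u v) pairs + count (λ (u , v) → is a b v u) pairs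
      ≤⟨ +-mono-≤ (bound a b λ _ _ → refl) (bound b a λ u v → ∧-comm ⌊ v Fin.≟ a ⌋ ⌊ u Fin.≟ b ⌋) ⟩
    2 ∎
    where
    open ≤-Reasoning
    pairs = cartesianProduct (allFin n) (allFin n)
    xor⇒removed : ∀ e r → T (e xor (e ∧ not r)) → T r
    xor⇒removed true true _ = tt
    bound : ∀ c d {p : Fin n × Fin n → Bool} → (∀ u v → p (u , v) ≡ is c d u v) → count p pairs ≤ 1
    bound c d p≡ = ≤-trans
      (≤-reflexive (count-cartesianProductWith _,_ (λ u → ⌊ u Fin.≟ c ⌋) (λ v → ⌊ v Fin.≟ d ⌋) p≡
        (allFin n) (allFin n)))
      (*-mono-≤ (count-≟≤1 c (allFin⁺ n)) (count-≟≤1 d (allFin⁺ n)))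

-- Deleting the edge between the vertices number i and j of each clique met in
-- turn destroys all cliques, at the cost of one edge per clique.
module _ (i j : Fin s) (i≢j : i ≢ j) where

  lead : Vec (Fin n) s → Fin n × Fin n
  lead x = lookup x i , lookup x j

  record Packing (G : Graph n) (candidates : List (Vec (Fin n) s)) : Set where
    field
      cliques   : List (Vec (Fin n) s)
      isClique  : All (Clique G) cliques
      distinct  : AllPairs (λ x y → lead x ≢ lead y) cliques
      rest      : Graph n
      rest⊆     : ∀ {u v} → Edge rest u v → Edge G u v
      noClique  : All (¬_ ∘ Clique rest) candidates
      distance≤ : distance G rest ≤ length cliques * 2

  greedyPacking : ∀ (G : Graph n) candidates → Packing G candidates
  greedyPacking G [] = record
    { cliques   = []
    ; isClique  = []
    ; distinct  = []
    ; rest      = G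
    ; rest⊆     = λ e → e
    ; noClique  = []
    ; distance≤ = ≤-reflexive (distance-refl G)
    }
  greedyPacking G (x ∷ xs) with clique? G x
  ... | no ¬clique = record
    { Packing p
    ; noClique = (λ clique → ¬clique λ k l k≢l → Packing.rest⊆ p (clique k l k≢l)) ∷ Packing.noClique p
    }
    where p = greedyPacking G xs
  ... | yes clique = record
    { cliques   = x ∷ p.cliques
    ; isClique  = clique ∷ All.map (λ c k l k≢l → removeEdge⊆ G a b (c k l k≢l)) p.isClique
    -- The later cliques live in `G-ab`; one with the same lead would contain the deleted edge.
    ; distinct  = All.map (λ c eq → let (a≡ , b≡) = ,-injective eq in
                    gone (subst₂ (Edge G-ab) (sym a≡) (sym b≡) (c i j i≢j))) p.isClique ∷ p.distinct
    ; rest      = p.rest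
    ; rest⊆     = removeEdge⊆ G a b ∘ p.rest⊆
    ; noClique  = (λ c → gone (p.rest⊆ (c i j i≢j))) ∷ p.noClique
    ; distance≤ = ≤-trans (distance-triangle G G-ab p.rest) (+-mono-≤ (distance-removeEdge G a b) p.distance≤)
    }
    where
    a = lookup x i
    b = lookup x j
    G-ab = removeEdge G a b
    gone = removeEdge-removes G a b
    module p = Packing (greedyPacking G-ab xs)

  packing : (G : Graph n) → Packing G (tuples (allFin n) s)
  packing {n} G = greedyPacking G (tuples (allFin n) s)

  packing-cliqueFree : ∀ (G : Graph n) → CliqueFree s (Packing.rest (packing G))
  packing-cliqueFree G = no-clique⇒cliqueFree (Packing.rest (packing G)) λ x →
    All.lookup (Packing.noClique (packing G)) (∈-tuples ∈-allFin x)

-- The algorithm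

-- If m > B the message is empty and decodes to junk.
encode : Vec Bool m → Message B
encode {m} {B} xs with m ≤? B
... | yes m≤B = xs ⟨≤⟩ m≤B
... | no  _   = [] ⟨≤⟩ z≤n

decode : Message B → Vec Bool m
decode {m = m} (_⟨≤⟩_ {l} xs _) with l ≟ m
... | yes refl = xs
... | no  _    = replicate m false

decode-encode : m ≤ B → (xs : Vec Bool m) → decode (encode {B = B} xs) ≡ xs
decode-encode {m} {B} m≤B xs with m ≤? B
... | no  m≰B = contradiction m≤B m≰B
... | yes _   with m ≟ m
...   | yes refl = refl
...   | no  m≢m  = contradiction refl m≢m

chunks₂ : ∀ k t ℓ → Vec Bool (k * (t * ℓ)) → Vec (Vec (Vec Bool ℓ) t) k
chunks₂ k t ℓ xs = Vec.map (chunks t ℓ) (chunks k (t * ℓ) xs)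

chunks₂-concat : (q : Vec (Vec (Vec Bool ℓ) t) k) → chunks₂ k t ℓ (concat (Vec.map concat q)) ≡ q
chunks₂-concat {ℓ} {t} {k} q = begin
  Vec.map (chunks t ℓ) (chunks k (t * ℓ) (concat (Vec.map concat q)))
    ≡⟨ cong (Vec.map (chunks t ℓ)) (chunks-concat (Vec.map concat q)) ⟩
  Vec.map (chunks t ℓ) (Vec.map concat q)                              ≡⟨ Vec.map-∘ (chunks t ℓ) concat q ⟨
  Vec.map (chunks t ℓ ∘ concat) q                                      ≡⟨ Vec.map-cong chunks-concat q ⟩
  Vec.map (λ x → x) q                                                  ≡⟨ Vec.map-id q ⟩
  q                                                                    ∎
  where open ≡-Reasoning

-- The port `w` only certifies that the degree is nonzero. That evidence is irrelevant, so the
-- results for different `w` are definitionally equal.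
pickPort : ∀ {d} → Fin d → Vec Bool r → Fin d
pickPort w = pick {{Fin.nonZeroIndex w}}

seeds : ∀ k t r → Vec Bool (k * (t * r)) → Fin k → Vec (Vec Bool r) t
seeds k t r z j = chunks t r (lookup (chunks k (t * r) z) j)

-- What one draw of ports can reveal.

module Sampling (N : Network n ℓ) (t r : ℕ) where
  open Network N hiding (graph)

  sampled : ∀ {v} → Fin (deg v) → Vec (Vec Bool r) t → Fin t → Fin n
  sampled {v} w y i = neighbour v (pickPort w (lookup y i))

  -- The neighbour `w` is searched for and not drawn, so only `t` of the `1 + t` other vertices cost
  -- a factor of the degree in probability. Adjacency to `v` holds automatically, as all these
  -- vertices lie behind ports of `v`.
  ExtendsToClique : Fin n → Vec (Vec Bool r) t → Set
  ExtendsToClique v y = ∃ λ (w : Fin (deg v)) →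
    (∀ i → Edge (graph N) (neighbour v w) (sampled w y i)) ×
    (∀ i i′ → i ≢ i′ → Edge (graph N) (sampled w y i) (sampled w y i′))

  abstract
    extendsToClique? : ∀ v y → Dec (ExtendsToClique v y)
    extendsToClique? v y = Fin.any? λ w →
      Fin.all? (λ i → T? _) ×-dec
      Fin.all? (λ i → Fin.all? λ i′ → ¬? (i Fin.≟ i′) →-dec T? _)

  neighbour-edge : ∀ v w → Edge (graph N) v (neighbour v w)
  neighbour-edge v w = proj₂ (Inverse.to (ports v) w)

  portTo : ∀ {u v} → Edge (graph N) u v → Fin (deg u)
  portTo {u} {v} e = Inverse.from (ports u) (v , e)

  neighbour-portTo : ∀ {u v} (e : Edge (graph N) u v) → neighbour u (portTo e) ≡ v
  neighbour-portTo {u} {v} e = cong proj₁ (Inverse.inverseˡ (ports u) refl)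

  neighbour-backPort : ∀ v w → neighbour (neighbour v w) (backPort v w) ≡ v
  neighbour-backPort v w = neighbour-portTo (Edge-sym (graph N) (neighbour-edge v w))

  -- The source of the one-sided error: a successful draw exhibits an actual clique.
  extendsToClique⇒contains : ∀ {v y} → ExtendsToClique v y → Contains (graph N) (K (2 + t))
  extendsToClique⇒contains {v} {y} (w , w~u , u~u) = contains-clique G f adjacent
    where
    G = graph N
    u = sampled w y
    f : Fin (2 + t) → Fin n
    f zero          = v
    f (suc zero)    = neighbour v w
    f (suc (suc i)) = u i
    adjacent : ∀ i j → i ≢ j → Edge G (f i) (f j)
    adjacent zero          zero          i≢j = contradiction refl i≢j
    adjacent zero          (suc zero)    i≢j = neighbour-edge v w
    adjacent zero          (suc (suc j)) i≢j = neighbour-edge v _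
    adjacent (suc zero)    zero          i≢j = Edge-sym G (neighbour-edge v w)
    adjacent (suc zero)    (suc zero)    i≢j = contradiction refl i≢j
    adjacent (suc zero)    (suc (suc j)) i≢j = w~u j
    adjacent (suc (suc i)) zero          i≢j = Edge-sym G (neighbour-edge v _)
    adjacent (suc (suc i)) (suc zero)    i≢j = Edge-sym G (w~u i)
    adjacent (suc (suc i)) (suc (suc j)) i≢j = u~u i j (λ i≡j → i≢j (cong (λ x → suc (suc x)) i≡j))

-- After learning the identifiers of its neighbours, a node sends those of the
-- drawn ones to all neighbours, each of which answers, for every identifier
-- received, whether it is adjacent to the node with that identifier.
module _ (k t r ℓ B : ℕ) where

  ID : Set
  ID = Vec Bool ℓ

  data TesterState (d : ℕ) : Set where
    start    : ID → (Fin k → Vec (Vec Bool r) t) → TesterState d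
    informed : (Fin d → ID) → (Fin k → Vec (Vec Bool r) t) → TesterState d
    asked    : (Fin d → ID) → (Fin k → Vec (Vec Bool r) t) → (Fin d → Vec (Vec ID t) k) → TesterState d
    answered : (Fin k → Vec (Vec Bool r) t) → (Fin d → Vec (Vec Bool t) k) → TesterState d

  query : ∀ {d} → (Fin d → ID) → (Fin k → Vec (Vec Bool r) t) → Fin d → Vec (Vec ID t) k
  query ids σ p = tabulate λ j → Vec.map (ids ∘ pickPort p) (σ j)

  knows : ∀ {d} → (Fin d → ID) → ID → Bool
  knows ids x = ⌊ Fin.any? (λ p → ≡-dec Bool._≟_ (ids p) x) ⌋

  reply : ∀ {d} → (Fin d → ID) → Vec (Vec ID t) k → Vec (Vec Bool t) k
  reply ids = Vec.map (Vec.map (knows ids))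

  -- `ExtendsToClique` as seen by the node: `w` has answered for its adjacency to the drawn
  -- vertices, and each drawn vertex, through its own port, for its adjacency to the others.
  CliqueFound : ∀ {d} → (Fin k → Vec (Vec Bool r) t) → (Fin d → Vec (Vec Bool t) k) → Set
  CliqueFound {d} σ answers = ∃ λ (j : Fin k) → ∃ λ (w : Fin d) →
    (∀ i → T (lookup (lookup (answers w) j) i)) ×
    (∀ i i′ → i ≢ i′ → T (lookup (lookup (answers (pickPort w (lookup (σ j) i))) j) i′))

  abstract
    cliqueFound? : ∀ {d} σ (answers : Fin d → _) → Dec (CliqueFound σ answers)
    cliqueFound? σ answers = Fin.any? λ j → Fin.any? λ w →
      Fin.all? (λ i → T? _) ×-dec
      Fin.all? (λ i → Fin.all? λ i′ → ¬? (i Fin.≟ i′) →-dec T? _)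

  send : ∀ {d} → TesterState d → Fin d → Message B
  send (start x σ)         p = encode x
  send (informed ids σ)    p = encode (concat (Vec.map concat (query ids σ p)))
  send (asked ids σ qs)    p = encode (concat (reply ids (qs p)))
  send (answered σ as)     p = [] ⟨≤⟩ z≤n

  update : ∀ {d} → TesterState d → (Fin d → Message B) → TesterState d
  update (start x σ)      msgs = informed (λ p → decode (msgs p)) σ
  update (informed ids σ) msgs = asked ids σ (λ p → chunks₂ k t ℓ (decode (msgs p)))
  update (asked ids σ qs) msgs = answered σ (λ p → chunks k t (decode (msgs p)))
  update (answered σ as)  msgs = answered σ as

  accept : ∀ {d} → TesterState d → Bool
  accept (answered σ as) = not ⌊ cliqueFound? σ as ⌋
  accept _               = true

  tester : Algorithm ℓ B
  tester = record
    { rounds = 3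
    ; coins  = k * (t * r)
    ; State  = TesterState
    ; init   = λ d x z → start x (seeds k t r z)
    ; send   = send
    ; update = update
    ; accept = accept
    }

  accept-answered : ∀ {d} {s : TesterState d} {σ as} → s ≡ answered σ as →
    Algorithm.accept tester s ≡ not ⌊ cliqueFound? σ as ⌋
  accept-answered refl = refl

  -- What the nodes know after three rounds.

  module _ (N : Network n ℓ) where
    open Network N hiding (graph)
    open Sampling N t r

    module _ (ω : Vec (Vec Bool (k * (t * r))) n) where

      seedsOf : Fin n → Fin k → Vec (Vec Bool r) t
      seedsOf v = seeds k t r (lookup ω v)

      idsOf : ∀ v → Fin (deg v) → ID
      idsOf v p = decode {B} (encode (ident (neighbour v p)))

      queryOf : ∀ v → Fin (deg v) → Vec (Vec ID t) k
      queryOf v = query (idsOf v) (seedsOf v)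

      queriesTo : ∀ v → Fin (deg v) → Vec (Vec ID t) k
      queriesTo v p = chunks₂ k t ℓ (decode {B} (encode (concat (Vec.map concat
                        (queryOf (neighbour v p) (backPort v p))))))

      answersTo : ∀ v → Fin (deg v) → Vec (Vec Bool t) k
      answersTo v p = chunks k t (decode {B} (encode (concat
                        (reply (idsOf (neighbour v p)) (queriesTo (neighbour v p) (backPort v p))))))

      open Execution tester N using (initial; after)

      -- The preceding definitions reproduce the messages exactly as received, with encoding and
      -- decoding, so three rounds compute to them.
      after-3 : ∀ v → after 3 (initial ω) v ≡ answered (seedsOf v) (answersTo v)
      after-3 v = refl

      accepts≡ : ∀ v → Execution.accepts tester N ω v ≡ not ⌊ cliqueFound? (seedsOf v) (answersTo v) ⌋
      accepts≡ v = step (after (rounds tester) (initial ω) v) (seedsOf v) (answersTo v) (after-3 v)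
        where
        step : ∀ (s : TesterState (deg v)) σ as → s ≡ answered σ as →
          Algorithm.accept tester s ≡ not ⌊ cliqueFound? σ as ⌋
        step s σ as eq = accept-answered eq

      -- The bounds are demanded only in the presence of a port. On a single node `⌈log₂ n ⌉` is 0
      -- and there is no bandwidth at all, but also no edge.
      module _ (enoughBandwidth : ∀ {v} → Fin (deg v) → ℓ ≤ B × k * (t * ℓ) ≤ B × k * t ≤ B) where

        idsOf≡ : ∀ v p → idsOf v p ≡ ident (neighbour v p)
        idsOf≡ v p = decode-encode (proj₁ (enoughBandwidth p)) _

        -- A node sends the same query through all its ports, since `pickPort` uses the port only as
        -- a certificate.
        queryOf-cong : ∀ {u v} → u ≡ v → ∀ p q → queryOf u p ≡ queryOf v q
        queryOf-cong refl p q = refl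

        answersTo≡ : ∀ v p → answersTo v p ≡ reply (idsOf (neighbour v p)) (queryOf v p)
        answersTo≡ v p = begin
          answersTo v p
            ≡⟨ cong (chunks k t) (decode-encode (proj₂ (proj₂ (enoughBandwidth p))) _) ⟩
          chunks k t (concat (reply ids (queriesTo u q)))
            ≡⟨ chunks-concat (reply ids (queriesTo u q)) ⟩
          reply ids (queriesTo u q)
            ≡⟨ cong (reply ids ∘ chunks₂ k t ℓ) (decode-encode (proj₁ (proj₂ (enoughBandwidth p))) _) ⟩
          reply ids (chunks₂ k t ℓ (concat (Vec.map concat (queryOf (neighbour u q) (backPort u q)))))
            ≡⟨ cong (reply ids) (chunks₂-concat _) ⟩
          reply ids (queryOf (neighbour u q) (backPort u q))
            -- The node behind the back port of `u` is `v` itself, so `u` answers the query of `v`.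
            ≡⟨ cong (reply ids) (queryOf-cong (neighbour-backPort v p) (backPort u q) p) ⟩
          reply ids (queryOf v p) ∎
          where
          open ≡-Reasoning
          u = neighbour v p
          q = backPort v p
          ids = idsOf u

        -- Uniqueness of identifiers lets a node recognise a neighbour by its identifier alone.
        knows⇔edge : ∀ u x → T (knows (idsOf u) (ident x)) ⇔ Edge (graph N) u x
        knows⇔edge u x = mk⇔
          (λ known →
             let (p , eq) = toWitness {a? = Fin.any? λ p → ≡-dec Bool._≟_ (idsOf u p) (ident x)} known in
             subst (Edge (graph N) u) (ident-unique (trans (sym (idsOf≡ u p)) eq)) (neighbour-edge u p))
          (λ e → fromWitness (portTo e , trans (idsOf≡ u (portTo e)) (cong ident (neighbour-portTo e))))

        lookup-answersTo : ∀ v p w j i →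
          lookup (lookup (answersTo v p) j) i ≡ knows (idsOf (neighbour v p)) (ident (sampled w (seedsOf v j) i))
        lookup-answersTo v p w j i = begin
          lookup (lookup (answersTo v p) j) i
            ≡⟨ cong (λ as → lookup (lookup as j) i) (answersTo≡ v p) ⟩
          lookup (lookup (reply ids (queryOf v p)) j) i
            ≡⟨ cong (λ as → lookup as i) (lookup-map j (Vec.map (knows ids)) (queryOf v p)) ⟩
          lookup (Vec.map (knows ids) (lookup (queryOf v p) j)) i
            ≡⟨ lookup-map i (knows ids) (lookup (queryOf v p) j) ⟩
          knows ids (lookup (lookup (queryOf v p) j) i)
            ≡⟨ cong (λ q → knows ids (lookup q i))
                 (lookup∘tabulate (λ j → Vec.map (idsOf v ∘ pickPort p) (seedsOf v j)) j) ⟩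
          knows ids (lookup (Vec.map (idsOf v ∘ pickPort p) (seedsOf v j)) i)
            -- Here `pickPort p` silently becomes `pickPort w`, the two being definitionally equal.
            ≡⟨ cong (knows ids) (lookup-map i (idsOf v ∘ pickPort p) (seedsOf v j)) ⟩
          knows ids (idsOf v (pickPort w (lookup (seedsOf v j) i)))
            ≡⟨ cong (knows ids) (idsOf≡ v _) ⟩
          knows ids (ident (sampled w (seedsOf v j) i)) ∎
          where
          open ≡-Reasoning
          ids = idsOf (neighbour v p)

        answer⇔edge : ∀ v p w j i →
          T (lookup (lookup (answersTo v p) j) i) ⇔ Edge (graph N) (neighbour v p) (sampled w (seedsOf v j) i)
        answer⇔edge v p w j i =
          subst (λ b → T b ⇔ Edge (graph N) (neighbour v p) (sampled w (seedsOf v j) i))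
                (sym (lookup-answersTo v p w j i)) (knows⇔edge (neighbour v p) _)

        cliqueFound⇔ : ∀ v → CliqueFound (seedsOf v) (answersTo v) ⇔
          (∃ λ (j : Fin k) → ExtendsToClique v (seedsOf v j))
        cliqueFound⇔ v = mk⇔
          (λ (j , w , w~u , u~u) → j , w ,
            (λ i → Equivalence.to (answer⇔edge v w w j i) (w~u i)) ,
            (λ i i′ i≢i′ → Equivalence.to
              (answer⇔edge v (pickPort w (lookup (seedsOf v j) i)) w j i′) (u~u i i′ i≢i′)))
          (λ (j , w , w~u , u~u) → j , w ,
            (λ i → Equivalence.from (answer⇔edge v w w j i) (w~u i)) ,
            (λ i i′ i≢i′ → Equivalence.from
              (answer⇔edge v (pickPort w (lookup (seedsOf v j) i)) w j i′) (u~u i i′ i≢i′)))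

        accepts⇔ : ∀ v → T (Execution.accepts tester N ω v) ⇔ (∀ j → ¬ ExtendsToClique v (seedsOf v j))
        accepts⇔ v = mk⇔
          (λ acc j ext → toWitnessFalse (subst T (accepts≡ v) acc) (Equivalence.from (cliqueFound⇔ v) (j , ext)))
          (λ none → subst T (sym (accepts≡ v)) (fromWitnessFalse λ found →
            let (j , ext) = Equivalence.to (cliqueFound⇔ v) found in none j ext))

-- The probability of rejection

degree≤maxDegree : ∀ (G : Graph n) v → degree G v ≤ maxDegree G
degree≤maxDegree {n} G v =
  All.lookup (xs≤max 0 (List.map (degree G) (allFin n))) (∈-map⁺ (degree G) (∈-allFin v))

degree≤n : ∀ (G : Graph n) v → degree G v ≤ n
degree≤n {n} G v = ≤-trans (length-filter (T? ∘ adj G v) (allFin n))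
  (≤-reflexive (length-tabulate {n = n} (λ x → x)))

n≤2^n : ∀ n → n ≤ 2 ^ n
n≤2^n zero    = z≤n
n≤2^n (suc n) = ≤-trans (+-mono-≤ (m^n>0 2 n) (n≤2^n n)) (+-monoʳ-≤ (2 ^ n) (m≤m+n (2 ^ n) 0))

none-not⇒all : ∀ (p : Fin n → Bool) → T (not (any (not ∘ p) (allFin n))) → ∀ v → T (p v)
none-not⇒all p none v with p v in eq
... | true  = _
... | false = contradiction
  (any⁺ (not ∘ p) (Any.map (λ { refl → subst (T ∘ not) (sym eq) _ }) (∈-allFin v)))
  (T-not none)

-- The `k` draws of a node are independent. The power is written as a product of a constant family
-- to fit `product*[M+sum]≤`.
count-seeds : ∀ (k t r : ℕ) (p : Vec (Vec Bool r) t → Bool) →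
  count (λ z → ⋀ λ j → p (seeds k t r z j)) (coinTosses (k * (t * r))) ≡
  product {k} (λ _ → count p (tuples (coinTosses r) t))
count-seeds k t r p = begin
  count (λ z → ⋀ λ j → p (seeds k t r z j)) (coinTosses (k * (t * r)))
    ≡⟨ count-chunks coin k (t * r) (λ y → ⋀ λ j → p (chunks t r (lookup y j))) ⟩
  count (λ y → ⋀ λ j → p (chunks t r (lookup y j))) (tuples (coinTosses (t * r)) k)
    ≡⟨ count-tuples {n = k} (coinTosses (t * r)) (λ _ → p ∘ chunks t r) ⟩
  product {k} (λ _ → count (p ∘ chunks t r) (coinTosses (t * r)))
    ≡⟨ product-const-cong k (count-chunks coin t r p) ⟩
  product {k} (λ _ → count p (tuples (coinTosses r) t)) ∎
  where
  open ≡-Reasoning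
  coin = true ∷ false ∷ []
  product-const-cong : ∀ k {a b} → a ≡ b → product {k} (λ _ → a) ≡ product {k} (λ _ → b)
  product-const-cong k refl = refl

-- Draws that hit a packed clique, and independent repetitions.

module _ (N : Network n ℓ) (t r : ℕ) where
  open Network N hiding (graph)
  open Sampling N t r

  private
    G = graph N

    draws : List (Vec (Vec Bool r) t)
    draws = tuples (coinTosses r) t

  -- Vertex number 1 of `x` is left out: it takes the role of the undrawn neighbour in
  -- `ExtendsToClique`. The existential `w` is only the certificate that `sampled` asks for.
  Hits : Vec (Fin n) (2 + t) → Fin n → Vec (Vec Bool r) t → Set
  Hits x v y = v ≡ lookup x zero × ∃ λ (w : Fin (deg v)) → ∀ i → sampled w y i ≡ lookup x (suc (suc i))

  abstract
    hits? : ∀ x v y → Dec (Hits x v y)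
    hits? x v y = v Fin.≟ lookup x zero ×-dec
      Fin.any? λ w → Fin.all? λ i → sampled w y i Fin.≟ lookup x (suc (suc i))

  hits⇒extendsToClique : ∀ {x v y} → Clique G x → Hits x v y → ExtendsToClique v y
  hits⇒extendsToClique {x} {v} {y} clique (refl , w′ , hit) = w ,
    (λ i → subst₂ (Edge G) (sym (neighbour-portTo x₀x₁)) (sym (hit i)) (clique (suc zero) (suc (suc i)) λ ())) ,
    (λ i i′ i≢i′ → subst₂ (Edge G) (sym (hit i)) (sym (hit i′))
      (clique (suc (suc i)) (suc (suc i′)) (λ eq → i≢i′ (Fin.suc-injective (Fin.suc-injective eq)))))
    where
    x₀x₁ = clique zero (suc zero) λ ()
    w = portTo x₀x₁

  -- Each of the `t` choices has to be one prescribed port, which has probability at least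
  -- `1 / (2 * maxDegree G)` by `2^r≤count-pick`; the choices are independent.
  count-hits : n ≤ 2 ^ r → ∀ {x} → Clique G x →
    (2 ^ r) ^ t ≤ count (λ y → ⌊ hits? x (lookup x zero) y ⌋) draws * (2 * maxDegree G) ^ t
  count-hits n≤2^r {x} clique = begin
    (2 ^ r) ^ t
      ≤⟨ ^≤product*^ (λ i → count (picks i) (coinTosses r)) single ⟩
    product (λ i → count (picks i) (coinTosses r)) * (2 * maxDegree G) ^ t
      ≡⟨ cong (_* (2 * maxDegree G) ^ t) (count-tuples (coinTosses r) picks) ⟨
    count (λ y → ⋀ λ i → picks i (lookup y i)) draws * (2 * maxDegree G) ^ t
      ≤⟨ *-monoˡ-≤ ((2 * maxDegree G) ^ t) (count-mono picks⇒hits draws) ⟩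
    count (λ y → ⌊ hits? x (lookup x zero) y ⌋) draws * (2 * maxDegree G) ^ t ∎
    where
    open ≤-Reasoning
    v = lookup x zero
    w : Fin (deg v)
    w = portTo (clique zero (suc zero) λ ())
    target : Fin t → Fin (deg v)
    target i = portTo (clique zero (suc (suc i)) λ ())
    picks : Fin t → Vec Bool r → Bool
    picks i bits = ⌊ pickPort w bits Fin.≟ target i ⌋
    single : ∀ i → 2 ^ r ≤ count (picks i) (coinTosses r) * (2 * maxDegree G)
    single i = ≤-trans
      (2^r≤count-pick {r = r} {{Fin.nonZeroIndex w}} (≤-trans (degree≤n G v) n≤2^r) (target i))
      (*-monoʳ-≤ (count (picks i) (coinTosses r)) (*-monoʳ-≤ 2 (degree≤maxDegree G v)))
    picks⇒hits : ∀ y → T (⋀ λ i → picks i (lookup y i)) → T ⌊ hits? x v y ⌋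
    picks⇒hits y all = fromWitness (refl , w , λ i →
      trans (cong (neighbour v) (toWitness (⋀⁻ all i))) (neighbour-portTo (clique zero (suc (suc i)) λ ())))

  hitsAny : List (Vec (Fin n) (2 + t)) → Fin n → Vec (Vec Bool r) t → Bool
  hitsAny xs v y = any (λ x → ⌊ hits? x v y ⌋) xs

  -- The events are disjoint: a draw that hits a clique determines its vertices
  -- number 0 and 2 + i₀.
  count-hitsAny : (i₀ : Fin t) → ∀ {M D} xs →
    All (λ x → M ≤ count (λ y → ⌊ hits? x (lookup x zero) y ⌋) draws * D) xs →
    AllPairs (λ x x′ → lead zero (suc (suc i₀)) (λ ()) x ≢ lead zero (suc (suc i₀)) (λ ()) x′) xs →
    length xs * M ≤ sum (λ v → count (hitsAny xs v) draws) * D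
  count-hitsAny i₀ [] _ _ = z≤n
  count-hitsAny i₀ {M} {D} (x ∷ xs) (large ∷ larges) (distinct ∷ distincts) = begin
    M + length xs * M
      ≤⟨ +-mono-≤ large (count-hitsAny i₀ xs larges distincts) ⟩
    count (λ y → ⌊ hits? x (lookup x zero) y ⌋) draws * D + sum (λ v → count (hitsAny xs v) draws) * D
      -- Spreading the count for `x` over all nodes allows the two sums to be merged node by node.
      ≤⟨ +-monoˡ-≤ _ (*-monoˡ-≤ D (term≤sum (λ v → count (λ y → ⌊ hits? x v y ⌋) draws) (lookup x zero))) ⟩
    sum (λ v → count (λ y → ⌊ hits? x v y ⌋) draws) * D + sum (λ v → count (hitsAny xs v) draws) * D
      ≡⟨ *-distribʳ-+ D (sum (λ v → count (λ y → ⌊ hits? x v y ⌋) draws)) _ ⟨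
    (sum (λ v → count (λ y → ⌊ hits? x v y ⌋) draws) + sum (λ v → count (hitsAny xs v) draws)) * D
      ≡⟨ cong (_* D) (∑-distrib-+ (λ v → count (λ y → ⌊ hits? x v y ⌋) draws) (λ v → count (hitsAny xs v) draws)) ⟨
    sum (λ v → count (λ y → ⌊ hits? x v y ⌋) draws + count (hitsAny xs v) draws) * D
      ≤⟨ *-monoˡ-≤ D (sum-mono λ v → ≤-reflexive (count-disjoint (disjoint v) draws)) ⟩
    sum (λ v → count (hitsAny (x ∷ xs) v) draws) * D ∎
    where
    open ≤-Reasoning
    disjoint : ∀ v y → T ⌊ hits? x v y ⌋ → T (hitsAny xs v y) → ⊥
    disjoint v y hit hit′ = clash distinct (any⁻ (λ x → ⌊ hits? x v y ⌋) xs hit′)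
      where
      clash : ∀ {xs} → All (λ x′ → lead zero (suc (suc i₀)) (λ ()) x ≢ lead zero (suc (suc i₀)) (λ ()) x′) xs →
              Any (λ x → T ⌊ hits? x v y ⌋) xs → ⊥
      clash (x≢x′ ∷ _) (Any.here h′) =
        let (v≡x₀  , _ , hit-x)  = toWitness hit
            (v≡x₀′ , _ , hit-x′) = toWitness h′
        in x≢x′ (cong₂ _,_ (trans (sym v≡x₀) v≡x₀′) (trans (sym (hit-x i₀)) (hit-x′ i₀)))
      clash (_ ∷ distinct) (Any.there h′) = clash distinct h′

  extensions : Fin n → ℕ
  extensions v = count (λ y → ⌊ extendsToClique? v y ⌋) draws

  -- A draw that hits any packed clique is successful, so the disjoint hitting events bound the
  -- total number of successes from below.
  packing≤extensions : n ≤ 2 ^ r → (i₀ : Fin t) → let open Packing (packing zero (suc (suc i₀)) (λ ()) G) in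
    length cliques * (2 ^ r) ^ t ≤ sum extensions * (2 * maxDegree G) ^ t
  packing≤extensions n≤2^r i₀ = ≤-trans
    (count-hitsAny i₀ cliques (All.map (λ {x} → count-hits n≤2^r {x}) isClique) distinct)
    (*-monoˡ-≤ ((2 * maxDegree G) ^ t) (sum-mono λ v → count-mono (hitsAny⇒extends v) draws))
    where
    open Packing (packing zero (suc (suc i₀)) (λ ()) G)
    hitsAny⇒extends : ∀ v y → T (hitsAny cliques v y) → T ⌊ extendsToClique? v y ⌋
    hitsAny⇒extends v y hit = fromWitness (go isClique (any⁻ (λ x → ⌊ hits? x v y ⌋) cliques hit))
      where
      go : ∀ {xs} → All (Clique G) xs → Any (λ x → T ⌊ hits? x v y ⌋) xs → ExtendsToClique v y
      go {x ∷ _} (clique ∷ _) (Any.here hit) = hits⇒extendsToClique {x} {v} {y} clique (toWitness {a? = hits? x v y} hit)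
      go (_ ∷ cliques) (Any.there hit)  = go cliques hit

  draws≡ : length draws ≡ (2 ^ r) ^ t
  draws≡ = trans (length-tuples (coinTosses r) t) (cong (_^ t) (length-coinTosses r))

  module _ (k B : ℕ)
           (enoughBandwidth : ∀ {v} → Fin (deg v) → ℓ ≤ B × k * (t * ℓ) ≤ B × k * t ≤ B) where

    private
      alg = tester k t r ℓ B
      M = (2 ^ r) ^ t
      outcomes = privateCoins n (k * (t * r))

      fails : Fin n → Vec Bool (k * (t * r)) → Bool
      fails v z = ⋀ λ j → not ⌊ extendsToClique? v (seeds k t r z j) ⌋

      misses : Fin n → ℕ
      misses v = count (λ y → not ⌊ extendsToClique? v y ⌋) draws

      instance
        M≢0 : NonZero M
        M≢0 = m^n≢0 (2 ^ r) t {{m^n≢0 2 r}}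

    accepts⇔′ : ∀ ω v → T (Execution.accepts alg N ω v) ⇔ (∀ j → ¬ ExtendsToClique v (seeds k t r (lookup ω v) j))
    accepts⇔′ ω v = accepts⇔ k t r ℓ B N ω enoughBandwidth v

    cliqueFree⇒allAccept : CliqueFree (2 + t) G → ∀ ω → ∀ v → T (Execution.accepts alg N ω v)
    cliqueFree⇒allAccept free ω v =
      Equivalence.from (accepts⇔′ ω v) λ j ext → free (extendsToClique⇒contains {v} {seeds k t r (lookup ω v) j} ext)

    -- If no node rejects, all draws of all nodes fail, and the private coins of the nodes are
    -- independent.
    count-noneRejects≤ : count (not ∘ someRejects alg N) outcomes ≤
      product λ v → count (fails v) (coinTosses (k * (t * r)))
    count-noneRejects≤ = ≤-trans (count-mono noneRejects⇒fails outcomes)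
      (≤-reflexive (count-tuples (coinTosses (k * (t * r))) fails))
      where
      noneRejects⇒fails : ∀ ω → T (not (someRejects alg N ω)) → T (⋀ λ v → fails v (lookup ω v))
      noneRejects⇒fails ω none = ⋀⁺ λ v → ⋀⁺ λ j →
        fromWitnessFalse (Equivalence.to (accepts⇔′ ω v) (none-not⇒all (Execution.accepts alg N ω) none v) j)

    -- One draw fails with probability `1 - x ≤ 1 / (1 + x)` for `x = a / M`, because
    -- `(M - a) * (M + a) ≤ M * M`. Then `product*[M+sum]≤` gives `1 / (1 + k * x)` for `k` draws.
    fails-bound : ∀ v → count (fails v) (coinTosses (k * (t * r))) * (M + k * extensions v) ≤ M ^ k * M
    fails-bound v = begin
      count (fails v) (coinTosses (k * (t * r))) * (M + k * a)
        ≡⟨ cong₂ (λ x y → x * (M + y)) (count-seeds k t r (λ y → not ⌊ extendsToClique? v y ⌋))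
             (sym (sum-const {k} a)) ⟩
      product {k} (λ _ → f) * (M + sum {k} (λ _ → a))
        ≤⟨ product*[M+sum]≤ {k} {M} {M} (λ _ → f) (λ _ → a) (λ _ → f*[M+a]≤M*M) ⟩
      M ^ k * M ∎
      where
      open ≤-Reasoning
      f = misses v
      a = extensions v
      a+f≡M : a + f ≡ M
      a+f≡M = trans (count-not (λ y → ⌊ extendsToClique? v y ⌋) draws) draws≡
      square : ∀ a f → f * (a + f + a) + a * a ≡ (a + f) * (a + f)
      square = solve-∀
      f*[M+a]≤M*M : f * (M + a) ≤ M * M
      f*[M+a]≤M*M = begin
        f * (M + a)             ≡⟨ cong (λ m → f * (m + a)) a+f≡M ⟨
        f * (a + f + a)         ≤⟨ m≤m+n _ _ ⟩
        f * (a + f + a) + a * a ≡⟨ square a f ⟩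
        (a + f) * (a + f)       ≡⟨ cong₂ _*_ a+f≡M a+f≡M ⟩
        M * M                   ∎

    length-outcomes : length outcomes ≡ (M ^ k) ^ n
    length-outcomes = trans (length-tuples (coinTosses (k * (t * r))) n) (cong (_^ n) (begin
      length (coinTosses (k * (t * r)))    ≡⟨ length-coinTosses (k * (t * r)) ⟩
      2 ^ (k * (t * r))                    ≡⟨ cong (2 ^_) (trans (*-comm k (t * r)) (cong (_* k) (*-comm t r))) ⟩
      2 ^ (r * t * k)                      ≡⟨ ^-*-assoc 2 (r * t) k ⟨
      (2 ^ (r * t)) ^ k                    ≡⟨ cong (_^ k) (^-*-assoc 2 r t) ⟨
      M ^ k                                ∎))
      where open ≡-Reasoning

    -- The hypothesis says that the success probabilities, weighted by `k`, sum to at least 2. A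
    -- second use of `product*[M+sum]≤`, now over the nodes, bounds the probability that no node
    -- rejects by `1 / (1 + 2)`.
    count-someRejects≥ : 2 * M ≤ k * sum extensions →
      2 * length outcomes ≤ count (someRejects alg N) outcomes * 3
    count-someRejects≥ many = +-cancelʳ-≤ (3 * S′) _ _ (begin
      2 * L + 3 * S′       ≤⟨ +-monoʳ-≤ (2 * L) 3S′≤L ⟩
      2 * L + L            ≡⟨ triple L ⟩
      L * 3                ≡⟨ cong (_* 3) (count-not (someRejects alg N) outcomes) ⟨
      (S + S′) * 3         ≡⟨ split S S′ ⟩
      S * 3 + 3 * S′       ∎)
      where
      open ≤-Reasoning
      L = length outcomes
      S = count (someRejects alg N) outcomes
      S′ = count (not ∘ someRejects alg N) outcomes
      triple : ∀ L → 2 * L + L ≡ L * 3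
      triple = solve-∀
      split : ∀ S S′ → (S + S′) * 3 ≡ S * 3 + 3 * S′
      split = solve-∀
      rotate : ∀ x M → 3 * x * M ≡ x * (M + 2 * M)
      rotate = solve-∀
      Π = product λ v → count (fails v) (coinTosses (k * (t * r)))
      3S′≤L : 3 * S′ ≤ L
      3S′≤L = *-cancelʳ-≤ _ _ M (begin
        3 * S′ * M                               ≤⟨ *-monoˡ-≤ M (*-monoʳ-≤ 3 count-noneRejects≤) ⟩
        3 * Π * M                                ≡⟨ rotate Π M ⟩
        Π * (M + 2 * M)                          ≤⟨ *-monoʳ-≤ Π (+-monoʳ-≤ M many) ⟩
        Π * (M + k * sum extensions)             ≡⟨ cong (λ s → Π * (M + s)) (sum-*ˡ k extensions) ⟨
        Π * (M + sum (λ v → k * extensions v))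
          ≤⟨ product*[M+sum]≤ (λ v → count (fails v) (coinTosses (k * (t * r)))) (λ v → k * extensions v) fails-bound ⟩
        (M ^ k) ^ n * M                          ≡⟨ cong (_* M) length-outcomes ⟨
        L * M                                    ∎)

-- Natural bounds from inequalities between reals

fromℚᵘ-mono-≤ : ∀ {p q} → p ℚᵘ.≤ q → fromℚᵘ p ℚ.≤ fromℚᵘ q
fromℚᵘ-mono-≤ {p} {q} p≤q = ℚ.toℚᵘ-cancel-≤
  (ℚᵘ.≤-respˡ-≃ (ℚᵘ.≃-sym (ℚ.toℚᵘ-fromℚᵘ p)) (ℚᵘ.≤-respʳ-≃ (ℚᵘ.≃-sym (ℚ.toℚᵘ-fromℚᵘ q)) p≤q))

fromℚᵘ-cancel-≤ : ∀ {p q} → fromℚᵘ p ℚ.≤ fromℚᵘ q → p ℚᵘ.≤ q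
fromℚᵘ-cancel-≤ {p} {q} p≤q =
  ℚᵘ.≤-respˡ-≃ (ℚ.toℚᵘ-fromℚᵘ p) (ℚᵘ.≤-respʳ-≃ (ℚ.toℚᵘ-fromℚᵘ q) (ℚ.toℚᵘ-mono-≤ p≤q))

cross-multiply-≤ : ∀ a b c d .{{_ : NonZero b}} .{{_ : NonZero d}} →
  a * d ≤ c * b → ℤ.+ a ℚ./ b ℚ.≤ ℤ.+ c ℚ./ d
cross-multiply-≤ a (suc b) c (suc d) ad≤cb = fromℚᵘ-mono-≤ {mkℚᵘ (ℤ.+ a) b} {mkℚᵘ (ℤ.+ c) d}
  (*≤* (subst₂ ℤ._≤_ (ℤ.pos-* a (suc d)) (ℤ.pos-* c (suc b)) (ℤ.+≤+ ad≤cb)))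

≡⇒/≡1 : ∀ {a b} .{{_ : NonZero b}} → a ≡ b → ℤ.+ a ℚ./ b ≡ 1ℚ
≡⇒/≡1 {a} {suc b} refl = ℚ.fromℚᵘ-cong {mkℚᵘ (ℤ.+ suc b) b} {mkℚᵘ (ℤ.+ 1) 0}
  (*≡* (ℤ.*-comm (ℤ.+ suc b) (ℤ.+ 1)))

ι : ℕ → ℚ
ι k = ℤ.+ k ℚ./ 1

ι-mono : ∀ {a b} → a ≤ b → ι a ℚ.≤ ι b
ι-mono {a} {b} a≤b = cross-multiply-≤ a 1 b 1 (*-monoˡ-≤ 1 a≤b)

ι-cancel : ∀ {a b} → ι a ℚ.≤ ι b → a ≤ b
ι-cancel {a} {b} le with fromℚᵘ-cancel-≤ {mkℚᵘ (ℤ.+ a) 0} {mkℚᵘ (ℤ.+ b) 0} le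
... | *≤* a≤b = ℤ.drop‿+≤+ (subst₂ ℤ._≤_ (ℤ.*-identityʳ (ℤ.+ a)) (ℤ.*-identityʳ (ℤ.+ b)) a≤b)

ι-+ : ∀ a b → ι (a + b) ≡ ι a ℚ.+ ι b
ι-+ a b = ℚ.toℚᵘ-injective (begin
  toℚᵘ (ι (a + b))
    ≈⟨ ℚ.toℚᵘ-fromℚᵘ (mkℚᵘ (ℤ.+ (a + b)) 0) ⟩
  mkℚᵘ (ℤ.+ (a + b)) 0
    ≈⟨ *≡* (cong (ℤ._* ℤ.+ 1) (cong₂ ℤ._+_ (sym (ℤ.*-identityʳ (ℤ.+ a))) (sym (ℤ.*-identityʳ (ℤ.+ b))))) ⟩
  mkℚᵘ (ℤ.+ a) 0 ℚᵘ.+ mkℚᵘ (ℤ.+ b) 0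
    ≈⟨ ℚᵘ.+-cong (ℚ.toℚᵘ-fromℚᵘ (mkℚᵘ (ℤ.+ a) 0)) (ℚ.toℚᵘ-fromℚᵘ (mkℚᵘ (ℤ.+ b) 0)) ⟨
  toℚᵘ (ι a) ℚᵘ.+ toℚᵘ (ι b)
    ≈⟨ ℚ.toℚᵘ-homo-+ (ι a) (ι b) ⟨
  toℚᵘ (ι a ℚ.+ ι b) ∎)
  where open import Relation.Binary.Reasoning.Setoid ℚᵘ.≃-setoid

ι-* : ∀ a b → ι (a * b) ≡ ι a ℚ.* ι b
ι-* a b = ℚ.toℚᵘ-injective (begin
  toℚᵘ (ι (a * b))
    ≈⟨ ℚ.toℚᵘ-fromℚᵘ (mkℚᵘ (ℤ.+ (a * b)) 0) ⟩
  mkℚᵘ (ℤ.+ (a * b)) 0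
    ≈⟨ *≡* (cong (ℤ._* ℤ.+ 1) (ℤ.pos-* a b)) ⟩
  mkℚᵘ (ℤ.+ a) 0 ℚᵘ.* mkℚᵘ (ℤ.+ b) 0
    ≈⟨ ℚᵘ.*-cong (ℚ.toℚᵘ-fromℚᵘ (mkℚᵘ (ℤ.+ a) 0)) (ℚ.toℚᵘ-fromℚᵘ (mkℚᵘ (ℤ.+ b) 0)) ⟨
  toℚᵘ (ι a) ℚᵘ.* toℚᵘ (ι b)
    ≈⟨ ℚ.toℚᵘ-homo-* (ι a) (ι b) ⟨
  toℚᵘ (ι a ℚ.* ι b) ∎)
  where open import Relation.Binary.Reasoning.Setoid ℚᵘ.≃-setoid

instance
  ι-nonNeg : ∀ {k} → ℚ.NonNegative (ι k)
  ι-nonNeg {k} = ℚ.normalize-nonNeg k 1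

-- Denominators are at least 1, so the absolute value of the numerator is a bound.
archimedean : ∀ q → q ℚ.≤ ι ℤ.∣ ↥ q ∣
archimedean q@(mkℚ i d _) = ℚ.≤-trans (ℚ.≤-reflexive (sym (ℚ.fromℚᵘ-toℚᵘ q)))
  (fromℚᵘ-mono-≤ {toℚᵘ q} {mkℚᵘ (ℤ.+ ℤ.∣ i ∣) 0} (*≤* (begin
    i ℤ.* ℤ.+ 1                ≡⟨ ℤ.*-identityʳ i ⟩
    i                          ≤⟨ i≤∣i∣ i ⟩
    ℤ.+ ℤ.∣ i ∣                ≤⟨ ℤ.+≤+ (m≤m*n ℤ.∣ i ∣ (suc d)) ⟩
    ℤ.+ (ℤ.∣ i ∣ * suc d)      ≡⟨ ℤ.pos-* ℤ.∣ i ∣ (suc d) ⟩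
    ℤ.+ ℤ.∣ i ∣ ℤ.* ℤ.+ suc d  ∎)))
  where
  open ℤ.≤-Reasoning
  i≤∣i∣ : ∀ i → i ℤ.≤ ℤ.+ ℤ.∣ i ∣
  i≤∣i∣ (ℤ.+ _)      = ℤ.≤-refl
  i≤∣i∣ ℤ.-[1+ _ ] = ℤ.-≤+

p≤∣p∣ : ∀ p → p ℚ.≤ ℚ.∣ p ∣
p≤∣p∣ p with ℚ.≤-total 0ℚ p
... | inj₁ 0≤p = ℚ.≤-reflexive (sym (ℚ.0≤p⇒∣p∣≡p 0≤p))
... | inj₂ p≤0 = ℚ.≤-trans p≤0 (ℚ.0≤∣p∣ p)

eventually-bounded : ∀ (x : ℝ) → ∃[ A ] ∃[ N ] (∀ i → N ≤ i → seq x i ℚ.≤ ι A)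
eventually-bounded x = ℤ.∣ ↥ bound ∣ , N , λ i N≤i → ℚ.≤-trans (begin
  seq x i
    ≡⟨ restore (seq x i) (seq x N) ⟩
  seq x i ℚ.- seq x N ℚ.+ seq x N
    ≤⟨ ℚ.+-monoˡ-≤ (seq x N) (ℚ.≤-trans (p≤∣p∣ (seq x i ℚ.- seq x N)) (close i N N≤i ≤-refl)) ⟩
  bound ∎) (archimedean bound)
  where
  open ℚ.≤-Reasoning
  0<1 : 0ℚ ℚ.< 1ℚ
  0<1 = ℚ.positive⁻¹ 1ℚ
  N = proj₁ (cauchy x 1ℚ 0<1)
  close = proj₂ (cauchy x 1ℚ 0<1)
  bound = 1ℚ ℚ.+ seq x N
  restore : ∀ p q → p ≡ p ℚ.- q ℚ.+ q
  restore p q = sym (trans (ℚ.+-assoc p (ℚ.- q) q) (trans (cong (p ℚ.+_) (ℚ.+-inverseˡ q)) (ℚ.+-identityʳ p)))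

-- If `b` were 0, allowing a slack strictly between 0 and `δ` would push `x i` below its lower bound
-- `δ`.
positive-below : ∀ {x : ℕ → ℚ} {δ N} {a b : ℕ} → 0ℚ ℚ.< δ → (∀ i → N ≤ i → δ ℚ.≤ x i) → 1 ≤ a →
  x *ˢ fromℕ a ≤ˢ fromℕ b → 1 ≤ b
positive-below {b = suc b} _ _ _ _ = s≤s z≤n
positive-below {x} {δ} {N} {a} {zero} 0<δ δ≤x 1≤a xa≤0 = ⊥-elim (ℚ.<-irrefl refl (begin-strict
  δ                  ≤⟨ δ≤x i (m≤m⊔n N M) ⟩
  x i                ≡⟨ ℚ.*-identityʳ (x i) ⟨
  x i ℚ.* ι 1        ≤⟨ ℚ.*-monoˡ-≤-nonNeg (x i) {{0≤xᵢ}} (ι-mono 1≤a) ⟩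
  x i ℚ.* ι a        ≤⟨ M-bound i (m≤n⊔m N M) ⟩
  0ℚ ℚ.+ δ′          ≡⟨ ℚ.+-identityˡ δ′ ⟩
  δ′                 <⟨ δ′<δ ⟩
  δ                  ∎))
  where
  open ℚ.≤-Reasoning
  mid = ℚ.<-dense 0<δ
  δ′ = proj₁ mid
  δ′<δ = proj₂ (proj₂ mid)
  M = proj₁ (xa≤0 δ′ (proj₁ (proj₂ mid)))
  M-bound = proj₂ (xa≤0 δ′ (proj₁ (proj₂ mid)))
  i = N ⊔ M
  0≤xᵢ : ℚ.NonNegative (x i)
  0≤xᵢ = ℚ.nonNegative (ℚ.≤-trans (ℚ.<⇒≤ 0<δ) (δ≤x i (m≤m⊔n N M)))

-- The product of `y` and `m` is eliminated as a whole. With `α` for `x` and `ε` for `y` this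
-- removes `ε` from the estimate, leaving a constant that depends on `α` alone. Each order relation
-- contributes a slack of 1.
combine-bounds : ∀ {x y : ℕ → ℚ} {A D m d N N′ : ℕ} →
  (∀ i → N ≤ i → 0ℚ ℚ.≤ x i) → (∀ i → N′ ≤ i → x i ℚ.≤ ι A) →
  fromℕ D ≤ˢ x *ˢ y *ˢ fromℕ m → y *ˢ fromℕ m ≤ˢ fromℕ d →
  D ≤ A * (d + 1) + 1
combine-bounds {x} {y} {A} {D} {m} {d} {N} {N′} 0≤x x≤A D≤xym ym≤d = ι-cancel (begin
  ι D                              ≤⟨ proj₂ D-bound i (≤-trans (m≤m⊔n N₁ N₂) (m≤n⊔m (N ⊔ N′) (N₁ ⊔ N₂))) ⟩
  x i ℚ.* y i ℚ.* ι m ℚ.+ 1ℚ       ≡⟨ cong (ℚ._+ 1ℚ) (ℚ.*-assoc (x i) (y i) (ι m)) ⟩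
  x i ℚ.* (y i ℚ.* ι m) ℚ.+ 1ℚ     ≤⟨ ℚ.+-monoˡ-≤ 1ℚ (ℚ.*-monoˡ-≤-nonNeg (x i) {{0≤xᵢ}} ym≤d+1) ⟩
  x i ℚ.* (ι d ℚ.+ 1ℚ) ℚ.+ 1ℚ      ≡⟨ cong (λ z → x i ℚ.* z ℚ.+ 1ℚ) (ι-+ d 1) ⟨
  x i ℚ.* ι (d + 1) ℚ.+ 1ℚ         ≤⟨ ℚ.+-monoˡ-≤ 1ℚ (ℚ.*-monoʳ-≤-nonNeg (ι (d + 1)) {{ι-nonNeg {d + 1}}} xᵢ≤A) ⟩
  ι A ℚ.* ι (d + 1) ℚ.+ 1ℚ         ≡⟨ cong (ℚ._+ 1ℚ) (ι-* A (d + 1)) ⟨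
  ι (A * (d + 1)) ℚ.+ 1ℚ           ≡⟨ ι-+ (A * (d + 1)) 1 ⟨
  ι (A * (d + 1) + 1)              ∎)
  where
  open ℚ.≤-Reasoning
  0<1 : 0ℚ ℚ.< 1ℚ
  0<1 = ℚ.positive⁻¹ 1ℚ
  D-bound = D≤xym 1ℚ 0<1
  d-bound = ym≤d 1ℚ 0<1
  N₁ = proj₁ D-bound
  N₂ = proj₁ d-bound
  i = (N ⊔ N′) ⊔ (N₁ ⊔ N₂)
  0≤xᵢ : ℚ.NonNegative (x i)
  0≤xᵢ = ℚ.nonNegative (0≤x i (≤-trans (m≤m⊔n N N′) (m≤m⊔n (N ⊔ N′) (N₁ ⊔ N₂))))
  xᵢ≤A = x≤A i (≤-trans (m≤n⊔m N N′) (m≤m⊔n (N ⊔ N′) (N₁ ⊔ N₂)))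
  ym≤d+1 = proj₂ d-bound i (≤-trans (m≤n⊔m N₁ N₂) (m≤n⊔m (N ⊔ N′) (N₁ ⊔ N₂)))

-- Choice of the constants, and the theorem.

^-distribʳ-* : ∀ a b t → (a * b) ^ t ≡ a ^ t * b ^ t
^-distribʳ-* a b zero    = refl
^-distribʳ-* a b (suc t) = trans (cong (a * b *_) (^-distribʳ-* a b t)) (interchange a b (a ^ t) (b ^ t))
  where
  interchange : ∀ a b x y → a * b * (x * y) ≡ a * x * (b * y)
  interchange = solve-∀

distinct⇒2≤n : ∀ {u v : Fin n} → u ≢ v → 2 ≤ n
distinct⇒2≤n {suc zero} {zero} {zero} u≢v = contradiction refl u≢v
distinct⇒2≤n {suc (suc n)} _ = s≤s (s≤s z≤n)

module _ (k t r ℓ B : ℕ) (N : Network n ℓ)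
         (enoughBandwidth : ∀ {v} → Fin (Network.deg N v) → ℓ ≤ B × k * (t * ℓ) ≤ B × k * t ≤ B) where

  Prob-allAccept : ∀ {A} → A ≡ tester k t r ℓ B → CliqueFree (2 + t) (graph N) → Prob A N (allAccept A N) ≡ 1ℚ
  Prob-allAccept {A} refl free = ≡⇒/≡1 {{privateCoins-nonZero n (k * (t * r))}}
    (count-all (λ ω → all⁻ (Execution.accepts A N ω)
                 (All.universal (cliqueFree⇒allAccept N t r k B enoughBandwidth free ω) (allFin n)))
               (privateCoins n (k * (t * r))))

  Prob-someRejects : ∀ {A} → A ≡ tester k t r ℓ B → 2 * (2 ^ r) ^ t ≤ k * sum (extensions N t r) →
    ℤ.+ 2 ℚ./ 3 ℚ.≤ Prob A N (someRejects A N)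
  Prob-someRejects {A} refl many = cross-multiply-≤ 2 3 (count (someRejects A N) Ω) (length Ω)
    {{_}} {{privateCoins-nonZero n (k * (t * r))}}
    (count-someRejects≥ N t r k B enoughBandwidth many)
    where Ω = privateCoins n (k * (t * r))

module Tester (t : ℕ) (i₀ : Fin t) (α : ℝ) (α>0 : Positive α) where

  abstract
    bound : ∃[ A ] ∃[ N ] (∀ i → N ≤ i → seq α i ℚ.≤ ι A)
    bound = eventually-bounded α

  αᵇ : ℕ
  αᵇ = proj₁ bound

  -- For p cliques in the packing, Δ ^ t ≤ (3 αᵇ + 1) p, and pick costs a factor
  -- of 2 for each of the t ports; success probabilities summing to 2 suffice
  -- for a failure probability of 1 / (1 + 2).
  abstract
    repeats : ℕ
    repeats = 2 * (2 ^ t * (3 * αᵇ + 1))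

    repeats≡ : repeats ≡ 2 * (2 ^ t * (3 * αᵇ + 1))
    repeats≡ = refl

  -- One summand for each kind of message: an identifier, a query of `repeats * t` identifiers, and
  -- a reply of `repeats * t` bits.
  bits : ℕ → ℕ
  bits c = c + repeats * (t * c) + repeats * t

  -- Each port is chosen with `n` coin tosses, which suffices because degrees are at most
  -- `n ≤ 2 ^ n`.
  algorithm : ∀ c → CongestAlgorithm c (bits c)
  algorithm c n ε = tester repeats t n (c * ⌈log₂ n ⌉) (bits c * ⌈log₂ n ⌉)

  -- Replies have constant length; they fit because `⌈log₂ n ⌉` is at least 1 once there are two
  -- nodes.
  enoughBandwidth : ∀ c → 2 ≤ n → let ℓ = c * ⌈log₂ n ⌉ ; B = bits c * ⌈log₂ n ⌉ in
    ℓ ≤ B × repeats * (t * ℓ) ≤ B × repeats * t ≤ B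
  enoughBandwidth {n} c 2≤n =
    *-monoˡ-≤ L (≤-trans (m≤m+n c (repeats * (t * c))) (m≤m+n _ (repeats * t))) ,
    ≤-trans (≤-reflexive (assoc repeats t c L))
      (*-monoˡ-≤ L (≤-trans (m≤n+m (repeats * (t * c)) c) (m≤m+n _ (repeats * t)))) ,
    ≤-trans (≤-reflexive (sym (*-identityʳ (repeats * t))))
      (*-mono-≤ (m≤n+m (repeats * t) (c + repeats * (t * c))) (⌈log₂⌉-mono-≤ 2≤n))
    where
    L = ⌈log₂ n ⌉
    assoc : ∀ q t c L → q * (t * (c * L)) ≡ q * (t * c) * L
    assoc = solve-∀

  module _ (ε : ℝ) (ε>0 : Positive ε) (c : ℕ) {n : ℕ} (N : Network n (c * ⌈log₂ n ⌉)) where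

    private
      G = graph N
      β = bits c * ⌈log₂ n ⌉
      Alg = algorithm c n ε
      M = (2 ^ n) ^ t

      bandwidth : ∀ {v} → Fin (Network.deg N v) →
        c * ⌈log₂ n ⌉ ≤ β × repeats * (t * (c * ⌈log₂ n ⌉)) ≤ β × repeats * t ≤ β
      bandwidth {v} w = enoughBandwidth c (distinct⇒2≤n (Edge⇒≢ G (Sampling.neighbour-edge N t n v w)))

    accepts-surely : CliqueFree (2 + t) G → Prob Alg N (allAccept Alg N) ≡ 1ℚ
    accepts-surely = Prob-allAccept repeats t n _ β N bandwidth {Alg} refl

    open Packing (packing {s = 2 + t} zero (suc (suc i₀)) (λ ()) G)

    module _ (far : FarFromCliqueFree (2 + t) ε G) where

      few-deletions : seq ε *ˢ fromℕ (size G) ≤ˢ fromℕ (length cliques * 2)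
      few-deletions δ 0<δ =
        let (N₀ , le) = far rest (packing-cliqueFree zero (suc (suc i₀)) (λ ()) G) δ 0<δ in
        N₀ , λ i N₀≤i → ℚ.≤-trans (le i N₀≤i) (ℚ.+-monoˡ-≤ δ (ι-mono distance≤))

      packing-nonempty : 1 ≤ size G → 1 ≤ length cliques
      packing-nonempty 1≤m =
        let (δ , 0<δ , _ , δ≤ε) = ε>0 in 1≤p*2⇒1≤p (length cliques) (positive-below 0<δ δ≤ε 1≤m few-deletions)
        where
        1≤p*2⇒1≤p : ∀ p → 1 ≤ p * 2 → 1 ≤ p
        1≤p*2⇒1≤p (suc p) _ = s≤s z≤n

      Δ^t≤ : SmallMaxDegree (2 + t) α ε G → 1 ≤ size G → maxDegree G ^ t ≤ (3 * αᵇ + 1) * length cliques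
      Δ^t≤ small 1≤m = begin
        maxDegree G ^ t
          ≤⟨ combine-bounds {seq α} {seq ε} {αᵇ} {maxDegree G ^ t} {size G} {p * 2}
               (λ i le → let (δ , 0<δ , _ , δ≤α) = α>0 in ℚ.≤-trans (ℚ.<⇒≤ 0<δ) (δ≤α i le))
               (proj₂ (proj₂ bound)) small few-deletions ⟩
        αᵇ * (p * 2 + 1) + 1
          -- Since the packing is nonempty, `p` absorbs both additive slacks of 1.
          ≤⟨ +-mono-≤ (*-monoʳ-≤ αᵇ (+-monoʳ-≤ (p * 2) 1≤p)) 1≤p ⟩
        αᵇ * (p * 2 + p) + p
          ≡⟨ collect αᵇ p ⟩
        (3 * αᵇ + 1) * p ∎
        where
        open ≤-Reasoning
        p = length cliques
        1≤p = packing-nonempty 1≤m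
        collect : ∀ a p → a * (p * 2 + p) + p ≡ (3 * a + 1) * p
        collect = solve-∀

      -- The packing size `p` is a factor of the lower bound on the successes and also of the upper
      -- bound on the power of the degree. It cancels, so that a constant number of repetitions
      -- suffices.
      many-extensions : SmallMaxDegree (2 + t) α ε G → 1 ≤ size G → 2 * M ≤ repeats * sum (extensions N t n)
      many-extensions small 1≤m = *-cancelˡ-≤ p {{>-nonZero (packing-nonempty 1≤m)}} (begin
        p * (2 * M)                             ≡⟨ swap p M ⟩
        2 * (p * M)                             ≤⟨ *-monoʳ-≤ 2 (packing≤extensions N t n (n≤2^n n) i₀) ⟩
        2 * (S * (2 * Δ) ^ t)                   ≡⟨ cong (λ x → 2 * (S * x)) (^-distribʳ-* 2 Δ t) ⟩
        2 * (S * (2 ^ t * Δ ^ t))               ≤⟨ *-monoʳ-≤ 2 (*-monoʳ-≤ S (*-monoʳ-≤ (2 ^ t) (Δ^t≤ small 1≤m))) ⟩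
        2 * (S * (2 ^ t * ((3 * αᵇ + 1) * p)))  ≡⟨ collect S (2 ^ t) (3 * αᵇ + 1) p ⟩
        p * (2 * (2 ^ t * (3 * αᵇ + 1)) * S)    ≡⟨ cong (λ x → p * (x * S)) repeats≡ ⟨
        p * (repeats * S)                       ∎)
        where
        open ≤-Reasoning
        p = length cliques
        Δ = maxDegree G
        S = sum (extensions N t n)
        swap : ∀ p M → p * (2 * M) ≡ 2 * (p * M)
        swap = solve-∀
        collect : ∀ S a b p → 2 * (S * (a * (b * p))) ≡ p * (2 * (a * b) * S)
        collect = solve-∀

      rejects-likely : SmallMaxDegree (2 + t) α ε G → 1 ≤ size G → ℤ.+ 2 ℚ./ 3 ℚ.≤ Prob Alg N (someRejects Alg N)
      rejects-likely small 1≤m = Prob-someRejects repeats t n _ β N bandwidth {Alg} refl (many-extensions small 1≤m)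

theorem6p7 : ∀ (s : ℕ) → 3 ≤ s → ∀ (α : ℝ) → Positive α →
    Σ ℕ λ R →
    ∀ (c : ℕ) →
    Σ ℕ λ b →
    Σ (CongestAlgorithm c b) λ A →
    ∀ (ε : ℝ) → Positive ε → seq ε ≤ˢ fromℕ 1 → ∀ (n : ℕ) →
    rounds (A n ε) ≤ R ×
    IsTester s n (SmallMaxDegree s α ε) (A n ε) ε ×
    HasOneSidedError s n (SmallMaxDegree s α ε) (A n ε)
theorem6p7 (suc (suc (suc t′))) (s≤s (s≤s (s≤s z≤n))) α α>0 =
  3 , λ c → bits c , algorithm c , λ ε ε>0 _ n →
  ≤-refl ,
  ((λ N _ free → ℚ.≤-trans (cross-multiply-≤ 2 3 1 1 (s≤s (s≤s z≤n)))
     (ℚ.≤-reflexive (sym (accepts-surely ε ε>0 c N free)))) ,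
   (λ N small 1≤m far → rejects-likely ε ε>0 c N far small 1≤m)) ,
  (λ N _ free → accepts-surely ε ε>0 c N free)
  -- The assumption `3 ≤ s` makes `t = suc t′` positive, so the deleted edge can end at the first of
  -- the last `t` vertices.
  where open Tester (suc t′) zero α α>0
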